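{- Let $d\ge 3$ be odd, let $k>2$ be an integer and let $V=(\mathbb{C}^k)^{\otimes d}$. Then it is not the case that for every integer $n\in[0,k^d-k]$ the linear map $$L:\bigwedge^n V\longrightarrow\bigwedge^{n+k}V,\qquad L(v)=\omega\wedge v,$$ has full rank; that is, there is an integer $n\in[0,k^d-k]$ for which $L:\bigwedge^n V\to\bigwedge^{n+k}V$ is neither injective nor surjective.
   Context: The Cayley form is $$\omega=\omega_{d,k}=\sum_{\pi_1,\ldots,\pi_d\in S_k}\mathrm{sgn}(\pi_1\cdots\pi_d)\bigwedge_{i=1}^k \left(e_{\pi_1(i)}\otimes\cdots\otimes e_{\pi_d(i)}\right)\in\bigwedge^k V,$$ where $e_1,\ldots,e_k$ is the standard basis of $\mathbb{C}^k$. -}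

module Defs where

open import Algebra.Bundles using (CommutativeRing)
open import Algebra.Module.Bundles using (Module)
open import Algebra.Module.Structures.Biased using (IsModuleFromLeft)
open import Algebra.Module.Morphism.Structures using (module ModuleMorphisms)
open import Data.Empty using (⊥)
open import Data.Fin.Base using (Fin; zero; suc; splitAt; _↑ˡ_; _↑ʳ_)
import Data.Fin.Base as Fin
import Data.Fin.Properties as Fin
open import Data.Fin.Permutation as Perm using (Permutation′; _⟨$⟩ʳ_; _∘ₚ_; insert; remove)
open import Data.List.Base as List using (List; allFin; cartesianProduct; cartesianProductWith; filter; foldr)
open import Data.List.Membership.Propositional.Properties using (∈-allFin)
import Data.List.Membership.Setoid as Membership
open import Data.List.Membership.Setoid.Properties using (∈-cartesianProductWith⁺; ∈-resp-≈)
open import Data.List.Relation.Unary.All using ([])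
open import Data.List.Relation.Unary.Any using (here)
open import Data.List.Relation.Unary.AllPairs using ([]; _∷_)
open import Data.List.Relation.Unary.Unique.Setoid using (Unique)
import Data.List.Relation.Unary.Unique.Setoid.Properties as Unique
import Data.List.Relation.Unary.Unique.Propositional.Properties as Unique≡
open import Data.Nat.Base as ℕ using (ℕ; zero; suc)
import Data.Nat.Properties as ℕ
open import Data.Product.Base using (_×_; _,_; proj₁; proj₂; ∃; ∃₂)
open import Data.Rational.Base using (ℚ; 0ℚ; 1ℚ; ½)
import Data.Rational.Base as Rat
import Data.Rational.Properties as Ratₚ
open import Data.Sum.Base using (_⊎_; inj₁; inj₂)
import Data.Vec.Functional as Vec
open Vec using (Vector; updateAt; _++_)
open import Data.Vec.Functional.Properties using (lookup-++ˡ; lookup-++ʳ; updateAt-updates; updateAt-minimal)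
open import Function.Base using (_∘_; const)
open import Function.Definitions using (Injective; Surjective)
open import Level using (Level; _⊔_; 0ℓ)
open import Relation.Binary.Bundles using (Setoid)
open import Relation.Binary.PropositionalEquality as ≡ using (_≡_; _≢_; refl; cong; subst)
open import Relation.Nullary using (yes; no; does)
open import Relation.Nullary.Decidable using (_×-dec_)
open import Data.Bool.Base using (if_then_else_)

private
  variable
    a r ℓ m ℓm p : Level

private
  module Identities (R : CommutativeRing r ℓ) where
    open CommutativeRing R
    open import Algebra.Properties.AbelianGroup +-abelianGroup using (⁻¹-∙-comm; //-rightDividesˡ)
    open import Algebra.Properties.CommutativeSemigroup +-commutativeSemigroup using (interchange)
    open import Algebra.Properties.Ring ring using (x[y-z]≈xy-xz)
    open import Relation.Binary.Reasoning.Setoid setoid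

    telescope : ∀ a b c → (a - b) + (b - c) ≈ a - c
    telescope a b c = trans (sym (+-assoc (a - b) b (- c))) (+-congʳ (//-rightDividesˡ b a))

    +-difference : ∀ a b c d → (a - b) + (c - d) ≈ (a + c) - (b + d)
    +-difference a b c d = trans (interchange a (- b) c (- d)) (+-congˡ (⁻¹-∙-comm b d))

    *-difference : ∀ a b c d → a * (c - d) + d * (a - b) ≈ a * c - b * d
    *-difference a b c d = begin
      a * (c - d) + d * (a - b)              ≈⟨ +-cong (x[y-z]≈xy-xz a c d) (x[y-z]≈xy-xz d a b) ⟩
      (a * c - a * d) + (d * a - d * b)      ≈⟨ +-congˡ (+-cong (*-comm d a) (-‿cong (*-comm d b))) ⟩
      (a * c - a * d) + (a * d - b * d)      ≈⟨ telescope (a * c) (a * d) (b * d) ⟩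
      a * c - b * d                          ∎

    recover : ∀ a b → a ≈ b + (a - b)
    recover a b = trans (sym (//-rightDividesˡ b a)) (+-comm (a - b) b)

------------------------------------------------------------------------
-- ℝ as the Cauchy completion of ℚ
------------------------------------------------------------------------

module Real where

  open Rat using (_+_; _*_; _-_; ∣_∣; _<_; _≤_) renaming (-_ to neg)

  open Identities Ratₚ.+-*-commutativeRing
  open import Algebra.Properties.Group Ratₚ.+-0-group using () renaming (⁻¹-anti-homo-// to neg-difference)

  Cauchy : (ℕ → ℚ) → Set
  Cauchy x = ∀ ε → 0ℚ < ε → ∃ λ N → ∀ i j → N ℕ.≤ i → N ℕ.≤ j → ∣ x i - x j ∣ < ε

  record ℝ : Set where
    constructor mkℝ
    field
      seq    : ℕ → ℚ
      cauchy : Cauchy seq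

  open ℝ public

  infix 4 _≃_

  record _≃_ (x y : ℝ) : Set where
    constructor mk≃
    field
      null : ∀ ε → 0ℚ < ε → ∃ λ N → ∀ i → N ℕ.≤ i → ∣ seq x i - seq y i ∣ < ε

  open _≃_ public

  private
    -- Smallness along a directed family, instantiated at ℕ for null sequences
    -- and at ℕ × ℕ for Cauchy sequences.
    module Small {I : Set} (_↓_ : ℕ → I → Set)
                 (mono : ∀ {M N i} → M ℕ.≤ N → N ↓ i → M ↓ i) where

      record IsSmall (z : I → ℚ) : Set where
        constructor mk
        field small : ∀ ε → 0ℚ < ε → ∃ λ N → ∀ i → N ↓ i → ∣ z i ∣ < ε

      open IsSmall public

      record IsBounded (z : I → ℚ) : Set where
        constructor mk
        field bound : ∃ λ B → 0ℚ < B × ∃ λ N → ∀ i → N ↓ i → ∣ z i ∣ ≤ B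

      resp : ∀ {y z} → (∀ i → y i ≡ z i) → IsSmall y → IsSmall z
      resp eq s .small ε ε>0 with small s ε ε>0
      ... | N , h = N , λ i n → subst (λ q → ∣ q ∣ < ε) (eq i) (h i n)

      zero-small : ∀ {z} → (∀ i → z i ≡ 0ℚ) → IsSmall z
      zero-small eq .small ε ε>0 = 0 , λ i _ → subst (λ q → ∣ q ∣ < ε) (≡.sym (eq i)) ε>0

      neg-small : ∀ {z} → IsSmall z → IsSmall (λ i → neg (z i))
      neg-small {z} s .small ε ε>0 with small s ε ε>0
      ... | N , h = N , λ i n → subst (_< ε) (≡.sym (Ratₚ.∣-p∣≡∣p∣ (z i))) (h i n)

      half>0 : ∀ {ε} → 0ℚ < ε → 0ℚ < ε * ½
      half>0 {ε} ε>0 = subst (_< ε * ½) (Ratₚ.*-zeroˡ ½) (Ratₚ.*-monoˡ-<-pos ½ ε>0)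

      halves : ∀ ε → ε * ½ + ε * ½ ≡ ε
      halves ε = ≡.trans (≡.sym (Ratₚ.*-distribˡ-+ ε ½ ½)) (Ratₚ.*-identityʳ ε)

      +-small : ∀ {y z} → IsSmall y → IsSmall z → IsSmall (λ i → y i + z i)
      +-small {y} {z} s t .small ε ε>0 with small s (ε * ½) (half>0 ε>0) | small t (ε * ½) (half>0 ε>0)
      ... | M , f | N , g = M ℕ.⊔ N , λ i n → begin-strict
        ∣ y i + z i ∣      ≤⟨ Ratₚ.∣p+q∣≤∣p∣+∣q∣ (y i) (z i) ⟩
        ∣ y i ∣ + ∣ z i ∣  <⟨ Ratₚ.+-mono-< (f i (mono (ℕ.m≤m⊔n M N) n)) (g i (mono (ℕ.m≤n⊔m M N) n)) ⟩
        ε * ½ + ε * ½      ≡⟨ halves ε ⟩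
        ε                  ∎
        where open Ratₚ.≤-Reasoning

      *-small : ∀ {y z} → IsBounded y → IsSmall z → IsSmall (λ i → y i * z i)
      *-small {y} {z} (mk (B , B>0 , M , f)) t .small ε ε>0 = K , bound
        where
        instance
          B-pos : Rat.Positive B
          B-pos = Rat.positive B>0
          B-nonZero : Rat.NonZero B
          B-nonZero = Ratₚ.pos⇒nonZero B
          B⁻¹-pos : Rat.Positive (Rat.1/ B)
          B⁻¹-pos = Ratₚ.1/pos⇒pos B
        δ : ℚ
        δ = ε * Rat.1/ B
        δ>0 : 0ℚ < δ
        δ>0 = subst (_< δ) (Ratₚ.*-zeroˡ (Rat.1/ B)) (Ratₚ.*-monoˡ-<-pos (Rat.1/ B) ε>0)
        Bδ : B * δ ≡ ε
        Bδ = ≡.trans (≡.sym (Ratₚ.*-assoc B ε (Rat.1/ B)))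
            (≡.trans (cong (_* Rat.1/ B) (Ratₚ.*-comm B ε))
            (≡.trans (Ratₚ.*-assoc ε B (Rat.1/ B))
            (≡.trans (cong (ε *_) (Ratₚ.*-inverseʳ B)) (Ratₚ.*-identityʳ ε))))
        K : ℕ
        K = M ℕ.⊔ proj₁ (small t δ δ>0)
        bound : ∀ i → K ↓ i → ∣ y i * z i ∣ < ε
        bound i n = begin-strict
          ∣ y i * z i ∣      ≡⟨ Ratₚ.∣p*q∣≡∣p∣*∣q∣ (y i) (z i) ⟩
          ∣ y i ∣ * ∣ z i ∣  ≤⟨ Ratₚ.*-monoʳ-≤-nonNeg ∣ z i ∣ {{Ratₚ.∣-∣-nonNeg (z i)}} (f i (mono (ℕ.m≤m⊔n M _) n)) ⟩
          B * ∣ z i ∣        <⟨ Ratₚ.*-monoʳ-<-pos B (proj₂ (small t δ δ>0) i (mono (ℕ.m≤n⊔m M _) n)) ⟩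
          B * δ              ≡⟨ Bδ ⟩
          ε                  ∎
          where open Ratₚ.≤-Reasoning

    module S₁ = Small ℕ._≤_ ℕ.≤-trans
    module S₂ = Small {ℕ × ℕ} (λ N ij → N ℕ.≤ proj₁ ij × N ℕ.≤ proj₂ ij)
                      (λ le (p , q) → ℕ.≤-trans le p , ℕ.≤-trans le q)

    Δ : ∀ (x : ℝ) → S₂.IsSmall (λ (i , j) → seq x i - seq x j)
    Δ x .S₂.small ε ε>0 with cauchy x ε ε>0
    ... | N , h = N , λ (i , j) (p , q) → h i j p q

    isCauchy : ∀ x → S₂.IsSmall (λ (i , j) → x i - x j) → Cauchy x
    isCauchy x c ε ε>0 with S₂.small c ε ε>0
    ... | N , h = N , λ i j p q → h (i , j) (p , q)

    ∇ : ∀ {x y} → x ≃ y → S₁.IsSmall (λ i → seq x i - seq y i)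
    ∇ e = S₁.mk (null e)

    equal : ∀ {x y} → S₁.IsSmall (λ i → seq x i - seq y i) → x ≃ y
    equal s = mk≃ (S₁.small s)

    bounded : ∀ (x : ℝ) → S₁.IsBounded (seq x)
    bounded x with cauchy x 1ℚ (Ratₚ.positive⁻¹ 1ℚ)
    ... | N , h = S₁.mk (B , B>0 , N , bound)
      where
      open Ratₚ.≤-Reasoning
      B : ℚ
      B = ∣ seq x N ∣ + 1ℚ
      B>0 : 0ℚ < B
      B>0 = Ratₚ.+-mono-≤-< (Ratₚ.0≤∣p∣ (seq x N)) (Ratₚ.positive⁻¹ 1ℚ)
      bound : ∀ i → N ℕ.≤ i → ∣ seq x i ∣ ≤ B
      bound i n = begin
        ∣ seq x i ∣                            ≡⟨ cong ∣_∣ (recover (seq x i) (seq x N)) ⟩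
        ∣ seq x N + (seq x i - seq x N) ∣      ≤⟨ Ratₚ.∣p+q∣≤∣p∣+∣q∣ (seq x N) (seq x i - seq x N) ⟩
        ∣ seq x N ∣ + ∣ seq x i - seq x N ∣    ≤⟨ Ratₚ.+-monoʳ-≤ ∣ seq x N ∣ (Ratₚ.<⇒≤ (h i N n ℕ.≤-refl)) ⟩
        B                                      ∎

    boundedˡ : ∀ (x : ℝ) → S₂.IsBounded (λ (i , _) → seq x i)
    boundedˡ x = let B , B>0 , N , h = S₁.IsBounded.bound (bounded x) in S₂.mk (B , B>0 , N , λ (i , _) (p , _) → h i p)

    boundedʳ : ∀ (x : ℝ) → S₂.IsBounded (λ (_ , j) → seq x j)
    boundedʳ x = let B , B>0 , N , h = S₁.IsBounded.bound (bounded x) in S₂.mk (B , B>0 , N , λ (_ , j) (_ , q) → h j q)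

  fromℚ : ℚ → ℝ
  fromℚ q = mkℝ (const q) (isCauchy (const q) (S₂.zero-small (λ _ → Ratₚ.+-inverseʳ q)))

  infixl 6 _+ᴿ_
  infixl 7 _*ᴿ_
  infix  8 -ᴿ_

  _+ᴿ_ : ℝ → ℝ → ℝ
  x +ᴿ y = mkℝ (λ i → seq x i + seq y i) (isCauchy (λ i → seq x i + seq y i) (S₂.resp
    (λ (i , j) → +-difference (seq x i) (seq x j) (seq y i) (seq y j))
    (S₂.+-small (Δ x) (Δ y))))

  -ᴿ_ : ℝ → ℝ
  -ᴿ x = mkℝ (λ i → neg (seq x i)) (isCauchy (λ i → neg (seq x i)) (S₂.resp
    (λ (i , j) → Ratₚ.neg-distrib-+ (seq x i) (neg (seq x j)))
    (S₂.neg-small (Δ x))))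

  _*ᴿ_ : ℝ → ℝ → ℝ
  x *ᴿ y = mkℝ (λ i → seq x i * seq y i) (isCauchy (λ i → seq x i * seq y i) (S₂.resp
    (λ (i , j) → *-difference (seq x i) (seq x j) (seq y i) (seq y j))
    (S₂.+-small (S₂.*-small (boundedˡ x) (Δ y))
                (S₂.*-small (boundedʳ y) (Δ x)))))

  private
    pointwise : ∀ {x y} → (∀ i → seq x i ≡ seq y i) → x ≃ y
    pointwise {x} {y} eq = equal (S₁.zero-small λ i →
      ≡.trans (cong (_- seq y i) (eq i)) (Ratₚ.+-inverseʳ (seq y i)))

    ≃-sym : ∀ {x y} → x ≃ y → y ≃ x
    ≃-sym {x} {y} e = equal (S₁.resp
      (λ i → neg-difference (seq x i) (seq y i))
      (S₁.neg-small (∇ e)))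

    ≃-trans : ∀ {x y z} → x ≃ y → y ≃ z → x ≃ z
    ≃-trans {x} {y} {z} e f = equal (S₁.resp
      (λ i → telescope (seq x i) (seq y i) (seq z i))
      (S₁.+-small (∇ e) (∇ f)))

    +-cong : ∀ {x y u v} → x ≃ y → u ≃ v → x +ᴿ u ≃ y +ᴿ v
    +-cong {x} {y} {u} {v} e f = equal (S₁.resp
      (λ i → +-difference (seq x i) (seq y i) (seq u i) (seq v i))
      (S₁.+-small (∇ e) (∇ f)))

    -‿cong : ∀ {x y} → x ≃ y → -ᴿ x ≃ -ᴿ y
    -‿cong {x} {y} e = equal (S₁.resp
      (λ i → Ratₚ.neg-distrib-+ (seq x i) (neg (seq y i)))
      (S₁.neg-small (∇ e)))

    *-cong : ∀ {x y u v} → x ≃ y → u ≃ v → x *ᴿ u ≃ y *ᴿ v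
    *-cong {x} {y} {u} {v} e f = equal (S₁.resp
      (λ i → *-difference (seq x i) (seq y i) (seq u i) (seq v i))
      (S₁.+-small (S₁.*-small (bounded x) (∇ f)) (S₁.*-small (bounded v) (∇ e))))

  commutativeRing : CommutativeRing 0ℓ 0ℓ
  commutativeRing = record
    { Carrier = ℝ ; _≈_ = _≃_ ; _+_ = _+ᴿ_ ; _*_ = _*ᴿ_ ; -_ = -ᴿ_ ; 0# = fromℚ 0ℚ ; 1# = fromℚ 1ℚ
    ; isCommutativeRing = record
      { isRing = record
        { +-isAbelianGroup = record
          { isGroup = record
            { isMonoid = record
              { isSemigroup = record
                { isMagma = record
                  { isEquivalence = record { refl = pointwise (λ _ → refl) ; sym = ≃-sym ; trans = ≃-trans }
                  ; ∙-cong = +-cong }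
                ; assoc = λ x y z → pointwise λ i → Ratₚ.+-assoc (seq x i) (seq y i) (seq z i) }
              ; identity = (λ x → pointwise λ i → Ratₚ.+-identityˡ (seq x i))
                         , (λ x → pointwise λ i → Ratₚ.+-identityʳ (seq x i)) }
            ; inverse = (λ x → pointwise λ i → Ratₚ.+-inverseˡ (seq x i))
                      , (λ x → pointwise λ i → Ratₚ.+-inverseʳ (seq x i))
            ; ⁻¹-cong = -‿cong }
          ; comm = λ x y → pointwise λ i → Ratₚ.+-comm (seq x i) (seq y i) }
        ; *-cong = *-cong
        ; *-assoc = λ x y z → pointwise λ i → Ratₚ.*-assoc (seq x i) (seq y i) (seq z i)
        ; *-identity = (λ x → pointwise λ i → Ratₚ.*-identityˡ (seq x i))
                     , (λ x → pointwise λ i → Ratₚ.*-identityʳ (seq x i))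
        ; distrib = (λ x y z → pointwise λ i → Ratₚ.*-distribˡ-+ (seq x i) (seq y i) (seq z i))
                  , (λ x y z → pointwise λ i → Ratₚ.*-distribʳ-+ (seq x i) (seq y i) (seq z i)) }
      ; *-comm = λ x y → pointwise λ i → Ratₚ.*-comm (seq x i) (seq y i) } }

------------------------------------------------------------------------
-- Adjoining a square root of -1 to a commutative ring
------------------------------------------------------------------------

-- The pair (a , b) stands for a + b i.
module Complexification (R : CommutativeRing r ℓ) where

  open CommutativeRing R renaming (refl to ≈-refl)

  _+ᶜ_ _*ᶜ_ : Carrier × Carrier → Carrier × Carrier → Carrier × Carrier
  (a , b) +ᶜ (c , d) = a + c , b + d
  (a , b) *ᶜ (c , d) = a * c - b * d , a * d + b * c

  -ᶜ_ : Carrier × Carrier → Carrier × Carrier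
  -ᶜ (a , b) = - a , - b

  _≈ᶜ_ : Carrier × Carrier → Carrier × Carrier → Set ℓ
  (a , b) ≈ᶜ (c , d) = a ≈ c × b ≈ d

  private
    open Identities R using (+-difference)
    open import Algebra.Properties.AbelianGroup +-abelianGroup using (⁻¹-∙-comm)
    open import Algebra.Properties.CommutativeSemigroup +-commutativeSemigroup using (interchange)
    open import Algebra.Properties.Ring ring using (-0#≈0#; x[y-z]≈xy-xz; [y-z]x≈yx-zx)
    open import Relation.Binary.Reasoning.Setoid setoid

    assocᶜ : ∀ x y z → ((x *ᶜ y) *ᶜ z) ≈ᶜ (x *ᶜ (y *ᶜ z))
    assocᶜ (a , b) (c , d) (e , f) =
        (begin
          (a * c - b * d) * e - (a * d + b * c) * f
            ≈⟨ +-cong ([y-z]x≈yx-zx e (a * c) (b * d)) (-‿cong (distribʳ f (a * d) (b * c))) ⟩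
          (a * c * e - b * d * e) - (a * d * f + b * c * f)
            ≈⟨ +-cong (+-cong (*-assoc a c e) (-‿cong (*-assoc b d e)))
                      (-‿cong (+-cong (*-assoc a d f) (*-assoc b c f))) ⟩
          (a * (c * e) - b * (d * e)) - (a * (d * f) + b * (c * f))
            ≈⟨ +-difference (a * (c * e)) (a * (d * f)) (- (b * (d * e))) (b * (c * f)) ⟨
          (a * (c * e) - a * (d * f)) + (- (b * (d * e)) - b * (c * f))
            ≈⟨ +-cong (sym (x[y-z]≈xy-xz a (c * e) (d * f)))
                      (trans (+-comm _ _) (trans (⁻¹-∙-comm _ _) (-‿cong (sym (distribˡ b (c * f) (d * e)))))) ⟩
          a * (c * e - d * f) - b * (c * f + d * e) ∎)
      , (begin
          (a * c - b * d) * f + (a * d + b * c) * e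
            ≈⟨ +-cong ([y-z]x≈yx-zx f (a * c) (b * d)) (distribʳ e (a * d) (b * c)) ⟩
          (a * c * f - b * d * f) + (a * d * e + b * c * e)
            ≈⟨ +-cong (+-cong (*-assoc a c f) (-‿cong (*-assoc b d f))) (+-cong (*-assoc a d e) (*-assoc b c e)) ⟩
          (a * (c * f) - b * (d * f)) + (a * (d * e) + b * (c * e))
            ≈⟨ interchange _ _ _ _ ⟩
          (a * (c * f) + a * (d * e)) + (- (b * (d * f)) + b * (c * e))
            ≈⟨ +-cong (sym (distribˡ a (c * f) (d * e)))
                      (trans (+-comm _ _) (sym (x[y-z]≈xy-xz b (c * e) (d * f)))) ⟩
          a * (c * f + d * e) + b * (c * e - d * f) ∎)

    distribˡᶜ : ∀ x y z → (x *ᶜ (y +ᶜ z)) ≈ᶜ ((x *ᶜ y) +ᶜ (x *ᶜ z))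
    distribˡᶜ (a , b) (c , d) (e , f) =
        trans (+-cong (distribˡ a c e) (-‿cong (distribˡ b d f)))
              (sym (+-difference (a * c) (b * d) (a * e) (b * f)))
      , trans (+-cong (distribˡ a d f) (distribˡ b c e)) (interchange _ _ _ _)

    commᶜ : ∀ x y → (x *ᶜ y) ≈ᶜ (y *ᶜ x)
    commᶜ (a , b) (c , d) = +-cong (*-comm a c) (-‿cong (*-comm b d))
                          , trans (+-comm (a * d) (b * c)) (+-cong (*-comm b c) (*-comm a d))

    identityʳᶜ : ∀ x → (x *ᶜ (1# , 0#)) ≈ᶜ x
    identityʳᶜ (a , b) =
        (begin
          a * 1# - b * 0#      ≈⟨ +-cong (*-identityʳ a) (-‿cong (zeroʳ b)) ⟩
          a - 0#               ≈⟨ +-congˡ -0#≈0# ⟩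
          a + 0#               ≈⟨ +-identityʳ a ⟩
          a                    ∎)
      , (begin
          a * 0# + b * 1#  ≈⟨ +-cong (zeroʳ a) (*-identityʳ b) ⟩
          0# + b           ≈⟨ +-identityˡ b ⟩
          b                ∎)

    trans² : ∀ x y z → x ≈ᶜ y → y ≈ᶜ z → x ≈ᶜ z
    trans² x y z (p , q) (p′ , q′) = trans p p′ , trans q q′

  commutativeRing : CommutativeRing r ℓ
  commutativeRing = record
    { Carrier = Carrier × Carrier
    ; _≈_ = _≈ᶜ_
    ; _+_ = _+ᶜ_ ; _*_ = _*ᶜ_ ; -_ = -ᶜ_ ; 0# = 0# , 0# ; 1# = 1# , 0#
    ; isCommutativeRing = record
      { isRing = record
        { +-isAbelianGroup = record
          { isGroup = record
            { isMonoid = record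
              { isSemigroup = record
                { isMagma = record
                  { isEquivalence = record
                    { refl = ≈-refl , ≈-refl
                    ; sym = λ (p , q) → sym p , sym q
                    ; trans = λ (p , q) (p′ , q′) → trans p p′ , trans q q′ }
                  ; ∙-cong = λ (p , q) (p′ , q′) → +-cong p p′ , +-cong q q′ }
                ; assoc = λ (a , b) (c , d) (e , f) → +-assoc a c e , +-assoc b d f }
              ; identity = (λ (a , b) → +-identityˡ a , +-identityˡ b)
                         , (λ (a , b) → +-identityʳ a , +-identityʳ b) }
            ; inverse = (λ (a , b) → -‿inverseˡ a , -‿inverseˡ b)
                      , (λ (a , b) → -‿inverseʳ a , -‿inverseʳ b)
            ; ⁻¹-cong = λ (p , q) → -‿cong p , -‿cong q }
          ; comm = λ (a , b) (c , d) → +-comm a c , +-comm b d }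
        ; *-cong = λ (p , q) (p′ , q′) → +-cong (*-cong p p′) (-‿cong (*-cong q q′))
                                       , +-cong (*-cong p q′) (*-cong q p′)
        ; *-assoc = assocᶜ
        ; *-identity = (λ x → trans² _ (x *ᶜ (1# , 0#)) x (commᶜ (1# , 0#) x) (identityʳᶜ x)) , identityʳᶜ
        ; distrib = distribˡᶜ
                  , (λ x y z → trans² _ (x *ᶜ (y +ᶜ z)) _ (commᶜ (y +ᶜ z) x) (trans² _ ((x *ᶜ y) +ᶜ (x *ᶜ z)) _ (distribˡᶜ x y z)
                      (let (p , q) = commᶜ x y ; (p′ , q′) = commᶜ x z in +-cong p p′ , +-cong q q′))) }
      ; *-comm = commᶜ } }

ℂ : CommutativeRing 0ℓ 0ℓ
ℂ = Complexification.commutativeRing Real.commutativeRing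

------------------------------------------------------------------------
-- Free modules, tensor powers and exterior powers
------------------------------------------------------------------------

infix 9 _^ᴹ_

_^ᴹ_ : (R : CommutativeRing r ℓ) → ℕ → Module R r ℓ
R ^ᴹ n = record
  { Carrierᴹ = Vector Carrier n
  ; _≈ᴹ_ = λ x y → ∀ i → x i ≈ y i
  ; _+ᴹ_ = λ x y i → x i + y i
  ; _*ₗ_ = λ s x i → s * x i
  ; _*ᵣ_ = λ x s i → s * x i
  ; 0ᴹ = λ _ → 0#
  ; -ᴹ_ = λ x i → - x i
  ; isModule = IsModuleFromLeft.isModule {commutativeRing = R} (record
    { isLeftModule = record
      { isLeftSemimodule = record
        { +ᴹ-isCommutativeMonoid = record
          { isMonoid = record
            { isSemigroup = record
              { isMagma = record
                { isEquivalence = record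
                  { refl = λ _ → ≈-refl
                  ; sym = λ p i → sym (p i)
                  ; trans = λ p q i → trans (p i) (q i) }
                ; ∙-cong = λ p q i → +-cong (p i) (q i) }
              ; assoc = λ x y z i → +-assoc (x i) (y i) (z i) }
            ; identity = (λ x i → +-identityˡ (x i)) , (λ x i → +-identityʳ (x i)) }
          ; comm = λ x y i → +-comm (x i) (y i) }
        ; isPreleftSemimodule = record
          { *ₗ-cong = λ p q i → *-cong p (q i)
          ; *ₗ-zeroˡ = λ x i → zeroˡ (x i)
          ; *ₗ-distribʳ = λ x s t i → distribʳ (x i) s t
          ; *ₗ-identityˡ = λ x i → *-identityˡ (x i)
          ; *ₗ-assoc = λ s t x i → *-assoc s t (x i)
          ; *ₗ-zeroʳ = λ s i → zeroʳ s
          ; *ₗ-distribˡ = λ s x y i → distribˡ s (x i) (y i) } }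
      ; -ᴹ‿cong = λ p i → -‿cong (p i)
      ; -ᴹ‿inverse = (λ x i → -‿inverseˡ (x i)) , (λ x i → -‿inverseʳ (x i)) } }) }
  where open CommutativeRing R renaming (refl to ≈-refl)

basis : (R : CommutativeRing r ℓ) {n : ℕ} → Fin n → Vector (CommutativeRing.Carrier R) n
basis R i j = if does (i Fin.≟ j) then 1# else 0#
  where open CommutativeRing R

-- The R-module generated by the symbols ⟨ x ⟩, for x an n-tuple of elements of M,
-- subject to the module axioms, multilinearity of ⟨_⟩ and ⟨ x ⟩ ≃ 𝟘 whenever
-- x is degenerate.  It is the universal target of n-ary multilinear maps out of M
-- vanishing on degenerate tuples.
module Multilinear (R : CommutativeRing r ℓ) (M : Module R m ℓm) (n : ℕ)
                   (Degenerate : Vector (Module.Carrierᴹ M) n → Set p) where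

  open CommutativeRing R
  open Module M using (Carrierᴹ; _≈ᴹ_; _+ᴹ_; _*ₗ_)

  infixl 6 _⊕_
  infixr 7 _⊙_
  infix  4 _≃_

  data Term : Set (r ⊔ m) where
    ⟨_⟩ : Vector Carrierᴹ n → Term
    𝟘   : Term
    _⊕_ : Term → Term → Term
    _⊙_ : Carrier → Term → Term

  data _≃_ : Term → Term → Set (r ⊔ ℓ ⊔ m ⊔ ℓm ⊔ p) where
    ≃-refl  : ∀ {t} → t ≃ t
    ≃-sym   : ∀ {t u} → t ≃ u → u ≃ t
    ≃-trans : ∀ {t u v} → t ≃ u → u ≃ v → t ≃ v

    ⟨⟩-cong : ∀ {x y} → (∀ i → x i ≈ᴹ y i) → ⟨ x ⟩ ≃ ⟨ y ⟩
    ⊕-cong  : ∀ {t t′ u u′} → t ≃ t′ → u ≃ u′ → t ⊕ u ≃ t′ ⊕ u′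
    ⊙-cong  : ∀ {a b t u} → a ≈ b → t ≃ u → a ⊙ t ≃ b ⊙ u

    ⊕-assoc     : ∀ t u v → (t ⊕ u) ⊕ v ≃ t ⊕ (u ⊕ v)
    ⊕-comm      : ∀ t u → t ⊕ u ≃ u ⊕ t
    ⊕-identityˡ : ∀ t → 𝟘 ⊕ t ≃ t
    ⊙-identityˡ : ∀ t → 1# ⊙ t ≃ t
    ⊙-assoc     : ∀ a b t → (a * b) ⊙ t ≃ a ⊙ (b ⊙ t)
    ⊙-distribˡ  : ∀ a t u → a ⊙ (t ⊕ u) ≃ a ⊙ t ⊕ a ⊙ u
    ⊙-distribʳ  : ∀ t a b → (a + b) ⊙ t ≃ a ⊙ t ⊕ b ⊙ t
    ⊙-zeroˡ     : ∀ t → 0# ⊙ t ≃ 𝟘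
    ⊙-zeroʳ     : ∀ a → a ⊙ 𝟘 ≃ 𝟘

    additive    : ∀ x i u v → ⟨ updateAt x i (const (u +ᴹ v)) ⟩
                              ≃ ⟨ updateAt x i (const u) ⟩ ⊕ ⟨ updateAt x i (const v) ⟩
    homogeneous : ∀ x i a u → ⟨ updateAt x i (const (a *ₗ u)) ⟩ ≃ a ⊙ ⟨ updateAt x i (const u) ⟩
    degenerate  : ∀ x → Degenerate x → ⟨ x ⟩ ≃ 𝟘

  private
    inverseˡ : ∀ t → (- 1#) ⊙ t ⊕ t ≃ 𝟘
    inverseˡ t = ≃-trans (⊕-cong ≃-refl (≃-sym (⊙-identityˡ t)))
                (≃-trans (≃-sym (⊙-distribʳ t (- 1#) 1#))
                (≃-trans (⊙-cong (-‿inverseˡ 1#) ≃-refl) (⊙-zeroˡ t)))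

  module′ : Module R (r ⊔ m) (r ⊔ ℓ ⊔ m ⊔ ℓm ⊔ p)
  module′ = record
    { Carrierᴹ = Term
    ; _≈ᴹ_ = _≃_
    ; _+ᴹ_ = _⊕_
    ; _*ₗ_ = _⊙_
    ; _*ᵣ_ = λ t a → a ⊙ t
    ; 0ᴹ = 𝟘
    ; -ᴹ_ = λ t → (- 1#) ⊙ t
    ; isModule = IsModuleFromLeft.isModule {commutativeRing = R} (record
      { isLeftModule = record
        { isLeftSemimodule = record
          { +ᴹ-isCommutativeMonoid = record
            { isMonoid = record
              { isSemigroup = record
                { isMagma = record
                  { isEquivalence = record { refl = ≃-refl ; sym = ≃-sym ; trans = ≃-trans }
                  ; ∙-cong = ⊕-cong }
                ; assoc = ⊕-assoc }
              ; identity = ⊕-identityˡ , (λ t → ≃-trans (⊕-comm t 𝟘) (⊕-identityˡ t)) }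
            ; comm = ⊕-comm }
          ; isPreleftSemimodule = record
            { *ₗ-cong = ⊙-cong
            ; *ₗ-zeroˡ = ⊙-zeroˡ
            ; *ₗ-distribʳ = ⊙-distribʳ
            ; *ₗ-identityˡ = ⊙-identityˡ
            ; *ₗ-assoc = ⊙-assoc
            ; *ₗ-zeroʳ = ⊙-zeroʳ
            ; *ₗ-distribˡ = ⊙-distribˡ } }
        ; -ᴹ‿cong = ⊙-cong (CommutativeRing.refl R)
        ; -ᴹ‿inverse = inverseˡ , (λ t → ≃-trans (⊕-comm t _) (inverseˡ t)) } }) }

module TensorPower (R : CommutativeRing r ℓ) (M : Module R m ℓm) (n : ℕ) where

  open Multilinear R M n (λ _ → ⊥) public

  infix 10 ⨂_

  ⨂_ : Vector (Module.Carrierᴹ M) n → Term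
  ⨂ x = ⟨ x ⟩

infix 9 _^⊗_

_^⊗_ : {R : CommutativeRing r ℓ} → Module R m ℓm → ℕ → Module R (r ⊔ m) (r ⊔ ℓ ⊔ m ⊔ ℓm)
_^⊗_ {R = R} M n = TensorPower.module′ R M n

module Exterior (R : CommutativeRing r ℓ) (M : Module R m ℓm) where

  private module R = CommutativeRing R
  open Module M using (Carrierᴹ; _≈ᴹ_; _+ᴹ_; _*ₗ_; ≈ᴹ-refl; ≈ᴹ-reflexive; ≈ᴹ-trans)

  HasRepetition : ∀ {n} → Vector Carrierᴹ n → Set ℓm
  HasRepetition x = ∃₂ λ i j → i ≢ j × x i ≈ᴹ x j

  module Power (n : ℕ) = Multilinear R M n HasRepetition

  ⋀ : ℕ → Module R (r ⊔ m) (r ⊔ ℓ ⊔ m ⊔ ℓm)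
  ⋀ n = Power.module′ n

  private module P {n : ℕ} = Power n
  open P

  ⋀-pure : ∀ {n} → Vector Carrierᴹ n → Term {n}
  ⋀-pure = ⟨_⟩

  infixr 8 _∧_

  _∧_ : ∀ {k n} → Term {k} → Term {n} → Term {k ℕ.+ n}
  ⟨ x ⟩   ∧ ⟨ y ⟩   = ⟨ x ++ y ⟩
  ⟨ x ⟩   ∧ 𝟘       = 𝟘
  ⟨ x ⟩   ∧ (u ⊕ v) = ⟨ x ⟩ ∧ u ⊕ ⟨ x ⟩ ∧ v
  ⟨ x ⟩   ∧ (a ⊙ u) = a ⊙ (⟨ x ⟩ ∧ u)
  𝟘       ∧ w       = 𝟘
  (t ⊕ u) ∧ w       = t ∧ w ⊕ u ∧ w
  (a ⊙ t) ∧ w       = a ⊙ (t ∧ w)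

  private
    ↑ʳ≢↑ˡ : ∀ {k n} (b : Fin n) (a : Fin k) → k ↑ʳ b ≢ a ↑ˡ n
    ↑ʳ≢↑ˡ {k} {n} b a eq with ≡.trans (≡.sym (Fin.splitAt-↑ʳ k n b)) (≡.trans (cong (splitAt k) eq) (Fin.splitAt-↑ˡ k a n))
    ... | ()

    ++-updateˡ : ∀ {k n} (x : Vector Carrierᴹ k) (y : Vector Carrierᴹ n) i f j →
                 (updateAt x i f ++ y) j ≡ updateAt (x ++ y) (i ↑ˡ n) f j
    ++-updateˡ {k} {n} x y i f j with splitAt k j in eq
    ... | inj₂ b with refl ← Fin.splitAt⁻¹-↑ʳ eq = begin
      y b                                        ≡⟨ lookup-++ʳ x y b ⟨
      (x ++ y) (k ↑ʳ b)                          ≡⟨ updateAt-minimal _ _ (x ++ y) (↑ʳ≢↑ˡ b i) ⟨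
      updateAt (x ++ y) (i ↑ˡ n) f (k ↑ʳ b)      ∎
      where open ≡.≡-Reasoning
    ... | inj₁ a with refl ← Fin.splitAt⁻¹-↑ˡ eq with a Fin.≟ i
    ...   | yes refl = begin
      updateAt x a f a                           ≡⟨ updateAt-updates a x ⟩
      f (x a)                                    ≡⟨ cong f (lookup-++ˡ x y a) ⟨
      f ((x ++ y) (a ↑ˡ n))                      ≡⟨ updateAt-updates (a ↑ˡ n) (x ++ y) ⟨
      updateAt (x ++ y) (a ↑ˡ n) f (a ↑ˡ n)      ∎
      where open ≡.≡-Reasoning
    ...   | no a≢i = begin
      updateAt x i f a                           ≡⟨ updateAt-minimal a i x a≢i ⟩
      x a                                        ≡⟨ lookup-++ˡ x y a ⟨
      (x ++ y) (a ↑ˡ n)                          ≡⟨ updateAt-minimal _ _ (x ++ y) (a≢i ∘ Fin.↑ˡ-injective n a i) ⟨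
      updateAt (x ++ y) (i ↑ˡ n) f (a ↑ˡ n)      ∎
      where open ≡.≡-Reasoning

    ++-updateʳ : ∀ {k n} (x : Vector Carrierᴹ k) (y : Vector Carrierᴹ n) i f j →
                 (x ++ updateAt y i f) j ≡ updateAt (x ++ y) (k ↑ʳ i) f j
    ++-updateʳ {k} {n} x y i f j with splitAt k j in eq
    ... | inj₁ a with refl ← Fin.splitAt⁻¹-↑ˡ eq = begin
      x a                                        ≡⟨ lookup-++ˡ x y a ⟨
      (x ++ y) (a ↑ˡ n)                          ≡⟨ updateAt-minimal _ _ (x ++ y) (↑ʳ≢↑ˡ i a ∘ ≡.sym) ⟨
      updateAt (x ++ y) (k ↑ʳ i) f (a ↑ˡ n)      ∎
      where open ≡.≡-Reasoning
    ... | inj₂ b with refl ← Fin.splitAt⁻¹-↑ʳ eq with b Fin.≟ i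
    ...   | yes refl = begin
      updateAt y b f b                           ≡⟨ updateAt-updates b y ⟩
      f (y b)                                    ≡⟨ cong f (lookup-++ʳ x y b) ⟨
      f ((x ++ y) (k ↑ʳ b))                      ≡⟨ updateAt-updates (k ↑ʳ b) (x ++ y) ⟨
      updateAt (x ++ y) (k ↑ʳ b) f (k ↑ʳ b)      ∎
      where open ≡.≡-Reasoning
    ...   | no b≢i = begin
      updateAt y i f b                           ≡⟨ updateAt-minimal b i y b≢i ⟩
      y b                                        ≡⟨ lookup-++ʳ x y b ⟨
      (x ++ y) (k ↑ʳ b)                          ≡⟨ updateAt-minimal _ _ (x ++ y) (b≢i ∘ Fin.↑ʳ-injective k b i) ⟨
      updateAt (x ++ y) (k ↑ʳ i) f (k ↑ʳ b)      ∎
      where open ≡.≡-Reasoning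

    ++-pointwise : ∀ {k n} {x x′ : Vector Carrierᴹ k} {y y′ : Vector Carrierᴹ n} →
                   (∀ i → x i ≈ᴹ x′ i) → (∀ i → y i ≈ᴹ y′ i) → ∀ i → (x ++ y) i ≈ᴹ (x′ ++ y′) i
    ++-pointwise {k} p q i with splitAt k i
    ... | inj₁ a = p a
    ... | inj₂ b = q b

    ≡⇒≃ : ∀ {n} {x y : Vector Carrierᴹ n} → (∀ i → x i ≡ y i) → ⟨ x ⟩ ≃ ⟨ y ⟩
    ≡⇒≃ eq = ⟨⟩-cong (λ i → ≈ᴹ-reflexive (eq i))

    repeatˡ : ∀ {k n} (x : Vector Carrierᴹ k) (y : Vector Carrierᴹ n) → HasRepetition x → HasRepetition (x ++ y)
    repeatˡ {n = n} x y (i , j , i≢j , eq) = i ↑ˡ n , j ↑ˡ n , i≢j ∘ Fin.↑ˡ-injective n i j ,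
      ≈ᴹ-trans (≈ᴹ-reflexive (lookup-++ˡ x y i)) (≈ᴹ-trans eq (≈ᴹ-reflexive (≡.sym (lookup-++ˡ x y j))))

    repeatʳ : ∀ {k n} (x : Vector Carrierᴹ k) (y : Vector Carrierᴹ n) → HasRepetition y → HasRepetition (x ++ y)
    repeatʳ {k} x y (i , j , i≢j , eq) = k ↑ʳ i , k ↑ʳ j , i≢j ∘ Fin.↑ʳ-injective k i j ,
      ≈ᴹ-trans (≈ᴹ-reflexive (lookup-++ʳ x y i)) (≈ᴹ-trans eq (≈ᴹ-reflexive (≡.sym (lookup-++ʳ x y j))))

    ⟨⟩∧-cong : ∀ {k n} (x : Vector Carrierᴹ k) {u v : Term {n}} → u ≃ v → ⟨ x ⟩ ∧ u ≃ ⟨ x ⟩ ∧ v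
    ⟨⟩∧-cong x ≃-refl            = ≃-refl
    ⟨⟩∧-cong x (≃-sym p)         = ≃-sym (⟨⟩∧-cong x p)
    ⟨⟩∧-cong x (≃-trans p q)     = ≃-trans (⟨⟩∧-cong x p) (⟨⟩∧-cong x q)
    ⟨⟩∧-cong x (⟨⟩-cong p)       = ⟨⟩-cong (++-pointwise (λ _ → ≈ᴹ-refl) p)
    ⟨⟩∧-cong x (⊕-cong p q)      = ⊕-cong (⟨⟩∧-cong x p) (⟨⟩∧-cong x q)
    ⟨⟩∧-cong x (⊙-cong p q)      = ⊙-cong p (⟨⟩∧-cong x q)
    ⟨⟩∧-cong x (⊕-assoc t u v)   = ⊕-assoc _ _ _
    ⟨⟩∧-cong x (⊕-comm t u)      = ⊕-comm _ _
    ⟨⟩∧-cong x (⊕-identityˡ t)   = ⊕-identityˡ _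
    ⟨⟩∧-cong x (⊙-identityˡ t)   = ⊙-identityˡ _
    ⟨⟩∧-cong x (⊙-assoc a b t)   = ⊙-assoc a b _
    ⟨⟩∧-cong x (⊙-distribˡ a t u) = ⊙-distribˡ a _ _
    ⟨⟩∧-cong x (⊙-distribʳ t a b) = ⊙-distribʳ _ a b
    ⟨⟩∧-cong x (⊙-zeroˡ t)       = ⊙-zeroˡ _
    ⟨⟩∧-cong x (⊙-zeroʳ a)       = ⊙-zeroʳ a
    ⟨⟩∧-cong x (additive y i u v) =
      ≃-trans (≡⇒≃ (++-updateʳ x y i _))
      (≃-trans (additive (x ++ y) (_ ↑ʳ i) u v)
        (≃-sym (⊕-cong (≡⇒≃ (++-updateʳ x y i _)) (≡⇒≃ (++-updateʳ x y i _)))))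
    ⟨⟩∧-cong x (homogeneous y i a u) =
      ≃-trans (≡⇒≃ (++-updateʳ x y i _))
      (≃-trans (homogeneous (x ++ y) (_ ↑ʳ i) a u)
        (⊙-cong R.refl (≃-sym (≡⇒≃ (++-updateʳ x y i _)))))
    ⟨⟩∧-cong x (degenerate y d)  = degenerate (x ++ y) (repeatʳ x y d)

    interchange : ∀ {n} (s t u v : Term {n}) → (s ⊕ t) ⊕ (u ⊕ v) ≃ (s ⊕ u) ⊕ (t ⊕ v)
    interchange s t u v =
      ≃-trans (⊕-assoc s t (u ⊕ v))
      (≃-trans (⊕-cong ≃-refl (≃-trans (≃-sym (⊕-assoc t u v))
                              (≃-trans (⊕-cong (⊕-comm t u) ≃-refl) (⊕-assoc u t v))))
      (≃-sym (⊕-assoc s u (t ⊕ v))))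

    ⊙-swap : ∀ {n} a b (t : Term {n}) → a ⊙ (b ⊙ t) ≃ b ⊙ (a ⊙ t)
    ⊙-swap a b t = ≃-trans (≃-sym (⊙-assoc a b t)) (≃-trans (⊙-cong (R.*-comm a b) ≃-refl) (⊙-assoc b a t))

    ⟨⟩-cong∧ : ∀ {k n} {x y : Vector Carrierᴹ k} → (∀ i → x i ≈ᴹ y i) → (w : Term {n}) → ⟨ x ⟩ ∧ w ≃ ⟨ y ⟩ ∧ w
    ⟨⟩-cong∧ p ⟨ z ⟩   = ⟨⟩-cong (++-pointwise p (λ _ → ≈ᴹ-refl))
    ⟨⟩-cong∧ p 𝟘       = ≃-refl
    ⟨⟩-cong∧ p (u ⊕ v) = ⊕-cong (⟨⟩-cong∧ p u) (⟨⟩-cong∧ p v)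
    ⟨⟩-cong∧ p (a ⊙ u) = ⊙-cong R.refl (⟨⟩-cong∧ p u)

    additive∧ : ∀ {k n} (x : Vector Carrierᴹ k) i u v (w : Term {n}) →
                ⟨ updateAt x i (const (u +ᴹ v)) ⟩ ∧ w
                  ≃ ⟨ updateAt x i (const u) ⟩ ∧ w ⊕ ⟨ updateAt x i (const v) ⟩ ∧ w
    additive∧ x i u v ⟨ z ⟩ =
      ≃-trans (≡⇒≃ (++-updateˡ x z i _))
      (≃-trans (additive (x ++ z) (i ↑ˡ _) u v)
        (≃-sym (⊕-cong (≡⇒≃ (++-updateˡ x z i _)) (≡⇒≃ (++-updateˡ x z i _)))))
    additive∧ x i u v 𝟘         = ≃-sym (⊕-identityˡ 𝟘)
    additive∧ x i u v (w₁ ⊕ w₂) =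
      ≃-trans (⊕-cong (additive∧ x i u v w₁) (additive∧ x i u v w₂)) (interchange _ _ _ _)
    additive∧ x i u v (a ⊙ w)   = ≃-trans (⊙-cong R.refl (additive∧ x i u v w)) (⊙-distribˡ a _ _)

    homogeneous∧ : ∀ {k n} (x : Vector Carrierᴹ k) i a u (w : Term {n}) →
                   ⟨ updateAt x i (const (a *ₗ u)) ⟩ ∧ w ≃ a ⊙ (⟨ updateAt x i (const u) ⟩ ∧ w)
    homogeneous∧ x i a u ⟨ z ⟩ =
      ≃-trans (≡⇒≃ (++-updateˡ x z i _))
      (≃-trans (homogeneous (x ++ z) (i ↑ˡ _) a u)
        (⊙-cong R.refl (≃-sym (≡⇒≃ (++-updateˡ x z i _)))))
    homogeneous∧ x i a u 𝟘         = ≃-sym (⊙-zeroʳ a)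
    homogeneous∧ x i a u (w₁ ⊕ w₂) =
      ≃-trans (⊕-cong (homogeneous∧ x i a u w₁) (homogeneous∧ x i a u w₂)) (≃-sym (⊙-distribˡ a _ _))
    homogeneous∧ x i a u (b ⊙ w)   = ≃-trans (⊙-cong R.refl (homogeneous∧ x i a u w)) (⊙-swap b a _)

    degenerate∧ : ∀ {k n} (x : Vector Carrierᴹ k) → HasRepetition x → (w : Term {n}) → ⟨ x ⟩ ∧ w ≃ 𝟘
    degenerate∧ x d ⟨ z ⟩     = degenerate (x ++ z) (repeatˡ x z d)
    degenerate∧ x d 𝟘         = ≃-refl
    degenerate∧ x d (w₁ ⊕ w₂) = ≃-trans (⊕-cong (degenerate∧ x d w₁) (degenerate∧ x d w₂)) (⊕-identityˡ 𝟘)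
    degenerate∧ x d (a ⊙ w)   = ≃-trans (⊙-cong R.refl (degenerate∧ x d w)) (⊙-zeroʳ a)

  ∧-congʳ : ∀ {k n} (t : Term {k}) {u v : Term {n}} → u ≃ v → t ∧ u ≃ t ∧ v
  ∧-congʳ ⟨ x ⟩   p = ⟨⟩∧-cong x p
  ∧-congʳ 𝟘       p = ≃-refl
  ∧-congʳ (s ⊕ t) p = ⊕-cong (∧-congʳ s p) (∧-congʳ t p)
  ∧-congʳ (a ⊙ t) p = ⊙-cong R.refl (∧-congʳ t p)

  ∧-congˡ : ∀ {k n} {t u : Term {k}} → t ≃ u → (w : Term {n}) → t ∧ w ≃ u ∧ w
  ∧-congˡ ≃-refl              w = ≃-refl
  ∧-congˡ (≃-sym p)           w = ≃-sym (∧-congˡ p w)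
  ∧-congˡ (≃-trans p q)       w = ≃-trans (∧-congˡ p w) (∧-congˡ q w)
  ∧-congˡ (⟨⟩-cong p)         w = ⟨⟩-cong∧ p w
  ∧-congˡ (⊕-cong p q)        w = ⊕-cong (∧-congˡ p w) (∧-congˡ q w)
  ∧-congˡ (⊙-cong p q)        w = ⊙-cong p (∧-congˡ q w)
  ∧-congˡ (⊕-assoc t u v)     w = ⊕-assoc _ _ _
  ∧-congˡ (⊕-comm t u)        w = ⊕-comm _ _
  ∧-congˡ (⊕-identityˡ t)     w = ⊕-identityˡ _
  ∧-congˡ (⊙-identityˡ t)     w = ⊙-identityˡ _
  ∧-congˡ (⊙-assoc a b t)     w = ⊙-assoc a b _
  ∧-congˡ (⊙-distribˡ a t u)  w = ⊙-distribˡ a _ _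
  ∧-congˡ (⊙-distribʳ t a b)  w = ⊙-distribʳ _ a b
  ∧-congˡ (⊙-zeroˡ t)         w = ⊙-zeroˡ _
  ∧-congˡ (⊙-zeroʳ a)         w = ⊙-zeroʳ a
  ∧-congˡ (additive x i u v)  w = additive∧ x i u v w
  ∧-congˡ (homogeneous x i a u) w = homogeneous∧ x i a u w
  ∧-congˡ (degenerate x d)    w = degenerate∧ x d w

  ∧-zeroʳ : ∀ {k n} (t : Term {k}) → t ∧ 𝟘 {n} ≃ 𝟘
  ∧-zeroʳ ⟨ x ⟩   = ≃-refl
  ∧-zeroʳ 𝟘       = ≃-refl
  ∧-zeroʳ (s ⊕ t) = ≃-trans (⊕-cong (∧-zeroʳ s) (∧-zeroʳ t)) (⊕-identityˡ 𝟘)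
  ∧-zeroʳ (a ⊙ t) = ≃-trans (⊙-cong R.refl (∧-zeroʳ t)) (⊙-zeroʳ a)

  ∧-distribˡ : ∀ {k n} (t : Term {k}) (u v : Term {n}) → t ∧ (u ⊕ v) ≃ t ∧ u ⊕ t ∧ v
  ∧-distribˡ ⟨ x ⟩   u v = ≃-refl
  ∧-distribˡ 𝟘       u v = ≃-sym (⊕-identityˡ 𝟘)
  ∧-distribˡ (s ⊕ t) u v = ≃-trans (⊕-cong (∧-distribˡ s u v) (∧-distribˡ t u v)) (interchange _ _ _ _)
  ∧-distribˡ (a ⊙ t) u v = ≃-trans (⊙-cong R.refl (∧-distribˡ t u v)) (⊙-distribˡ a _ _)

  ∧-homogeneousʳ : ∀ {k n} (t : Term {k}) a (u : Term {n}) → t ∧ (a ⊙ u) ≃ a ⊙ (t ∧ u)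
  ∧-homogeneousʳ ⟨ x ⟩   a u = ≃-refl
  ∧-homogeneousʳ 𝟘       a u = ≃-sym (⊙-zeroʳ a)
  ∧-homogeneousʳ (s ⊕ t) a u =
    ≃-trans (⊕-cong (∧-homogeneousʳ s a u) (∧-homogeneousʳ t a u)) (≃-sym (⊙-distribˡ a _ _))
  ∧-homogeneousʳ (b ⊙ t) a u = ≃-trans (⊙-cong R.refl (∧-homogeneousʳ t a u)) (⊙-swap b a _)

  ∧-isModuleHomomorphism : ∀ {k n} (t : Term {k}) →
    ModuleMorphisms.IsModuleHomomorphism (Module.rawModule (⋀ n)) (Module.rawModule (⋀ (k ℕ.+ n))) (t ∧_)
  ∧-isModuleHomomorphism t = record
    { isBimoduleHomomorphism = record
      { +ᴹ-isGroupHomomorphism = record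
        { isMonoidHomomorphism = record
          { isMagmaHomomorphism = record
            { isRelHomomorphism = record { cong = ∧-congʳ t }
            ; homo = ∧-distribˡ t }
          ; ε-homo = ∧-zeroʳ t }
        ; ⁻¹-homo = ∧-homogeneousʳ t _ }
      ; *ₗ-homo = ∧-homogeneousʳ t
      ; *ᵣ-homo = ∧-homogeneousʳ t } }

-- For finite-dimensional vector spaces, a linear map has rank
-- min (dim M) (dim N) precisely when it is injective or surjective.
FullRank : {R : CommutativeRing r ℓ} (M : Module R m ℓm) (N : Module R m ℓm) →
           (Module.Carrierᴹ M → Module.Carrierᴹ N) → Set (m ⊔ ℓm)
FullRank M N f = Injective (Module._≈ᴹ_ M) (Module._≈ᴹ_ N) f ⊎ Surjective (Module._≈ᴹ_ M) (Module._≈ᴹ_ N) f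

------------------------------------------------------------------------
-- Permutations
------------------------------------------------------------------------

-- The elements of S_n: insert zero j π sends zero to j and maps the remaining
-- elements to those different from j in the way prescribed by π.
permutations : ∀ n → List (Permutation′ n)
permutations zero    = Perm.id List.∷ List.[]
permutations (suc n) = cartesianProductWith (insert zero) (allFin (suc n)) (permutations n)

private
  permSetoid : ℕ → Setoid 0ℓ 0ℓ
  permSetoid n = record
    { Carrier = Permutation′ n
    ; _≈_ = Perm._≈_
    ; isEquivalence = record
      { refl = λ _ → refl
      ; sym = λ p i → ≡.sym (p i)
      ; trans = λ p q i → ≡.trans (p i) (q i) } }

permutations-complete : ∀ {n} (π : Permutation′ n) → Membership._∈_ (permSetoid n) π (permutations n)
permutations-complete {zero}  π = here λ ()
permutations-complete {suc n} π = ∈-resp-≈ (permSetoid (suc n))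
  {x = insert zero (π ⟨$⟩ʳ zero) (remove zero π)} {y = π} (Perm.insert-remove zero π)
  (∈-cartesianProductWith⁺ (≡.setoid _) (permSetoid n) (permSetoid (suc n))
    (λ { {x = j} {u = ρ} {v = σ} refl ρ≈σ → insert-cong j ρ σ ρ≈σ })
    (∈-allFin (π ⟨$⟩ʳ zero)) (permutations-complete (remove zero π)))
  where
  insert-cong : ∀ j (ρ σ : Permutation′ n) → ρ Perm.≈ σ → insert zero j ρ Perm.≈ insert zero j σ
  insert-cong j ρ σ eq zero    = refl
  insert-cong j ρ σ eq (suc i) = cong (Fin.punchIn j) (eq i)

permutations-unique : ∀ n → Unique (permSetoid n) (permutations n)
permutations-unique zero    = [] ∷ []
permutations-unique (suc n) =
  Unique.cartesianProductWith⁺ (≡.setoid _) (permSetoid n) (permSetoid (suc n)) (insert zero)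
    (λ {i} {j} {ρ} {σ} → insert-injective i j ρ σ) (Unique≡.allFin⁺ (suc n)) (permutations-unique n)
  where
  insert-injective : ∀ i j (ρ σ : Permutation′ n) → insert zero i ρ Perm.≈ insert zero j σ → i ≡ j × ρ Perm.≈ σ
  insert-injective i j ρ σ eq with refl ← eq zero =
    refl , λ k → Fin.punchIn-injective i (ρ ⟨$⟩ʳ k) (σ ⟨$⟩ʳ k) (eq (suc k))

inversions : ∀ {n} → Permutation′ n → ℕ
inversions {n} π = List.length
  (filter (λ (i , j) → (i Fin.<? j) ×-dec ((π ⟨$⟩ʳ j) Fin.<? (π ⟨$⟩ʳ i))) (cartesianProduct (allFin n) (allFin n)))

-- _∘ₚ_ composes in diagrammatic order, so this is the product π₁ ⋯ π_d under
-- which i is sent to π₁ (⋯ (π_d i)).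
composite : ∀ {n d} → Vector (Permutation′ n) d → Permutation′ n
composite = Vec.foldr (λ π ρ → ρ ∘ₚ π) Perm.id

tuples : ∀ {A : Set a} → List A → ∀ d → List (Vector A d)
tuples xs zero    = Vec.[] List.∷ List.[]
tuples xs (suc d) = cartesianProductWith Vec._∷_ xs (tuples xs d)

------------------------------------------------------------------------
-- The Cayley form
------------------------------------------------------------------------

module Cayley (R : CommutativeRing r ℓ) (d k : ℕ) where

  open CommutativeRing R using (Carrier; 1#; -_; semiring)
  open import Algebra.Properties.Semiring.Exp semiring using (_^_)

  V : Module R r (r ⊔ ℓ)
  V = (R ^ᴹ k) ^⊗ d

  open TensorPower R (R ^ᴹ k) d using (⨂_)
  open Exterior R V public using (⋀; ⋀-pure; _∧_)

  sgn : Permutation′ k → Carrier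
  sgn π = (- 1#) ^ inversions π

  summand : Vector (Permutation′ k) d → Module.Carrierᴹ (⋀ k)
  summand π = sgn (composite π) *ₗ ⋀-pure (λ i → ⨂ (λ j → basis R (π j ⟨$⟩ʳ i)))
    where open Module (⋀ k) using (_*ₗ_)

  ω : Module.Carrierᴹ (⋀ k)
  ω = foldr _+ᴹ_ 0ᴹ (List.map summand (tuples (permutations k) d))
    where open Module (⋀ k) using (_+ᴹ_; 0ᴹ)

  L : ∀ n → Module.Carrierᴹ (⋀ n) → Module.Carrierᴹ (⋀ (k ℕ.+ n))
  L n v = ω ∧ v

{-# OPTIONS --safe #-}
module Submission where

-- Take n = k ^ (d - 1), the number of basis tensors whose first index is 0.  The wedge of
-- these tensors is a nonzero element killed by ω, because every term of ω contains
-- one of them as a factor.  For the same reason the dual of the wedge of n + k distinct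
-- basis tensors with nonzero first index vanishes on the image of L, so L misses that
-- wedge; since k > 2 there are enough such tensors.  That a wedge of distinct basis
-- tensors does not vanish is seen by letting it act on a Fock space.

open import Defs
open import Algebra.Bundles using (CommutativeMonoid; CommutativeRing)
open import Algebra.Module.Bundles using (Module)
open import Algebra.Module.Construct.DirectProduct using (⟨module⟩)
import Algebra.Module.Construct.TensorUnit as TensorUnit
import Algebra.Properties.CommutativeSemigroup as CommutativeSemigroupProperties
open import Data.Empty using (⊥)
open import Data.Fin.Base using (Fin; zero; suc; _↑ˡ_; _↑ʳ_; finToFun; funToFin; inject≤; remQuot; combine)
open import Data.Fin.Permutation using (Permutation′; _⟨$⟩ʳ_; _⟨$⟩ˡ_; inverseʳ)
open import Data.Fin.Properties using (_≟_; suc-injective; inject≤-injective; combine-remQuot; funToFin-finToFin; finToFun-funToFin; ¬∀⟶∃¬; 0≢1+n)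
open import Data.List.Base as List using ([]; _∷_; foldr)
open import Data.Nat using (ℕ; zero; suc; _≤_; _<_; _+_; _*_; _∸_; _^_; _%_; s≤s)
import Data.Nat.Properties as ℕ
open import Data.Product using (_×_; _,_; proj₁; proj₂; ∃-syntax; uncurry)
open import Data.Rational.Base using (1ℚ)
import Data.Rational.Properties as ℚ
open import Data.Sum using ([_,_]′)
open import Data.Vec.Functional using (Vector; head; tail; updateAt; _++_)
open import Data.Vec.Functional.Properties using (lookup-++ˡ; lookup-++ʳ)
open import Function.Base using (_∘_; const)
open import Function.Definitions using (Injective; Surjective)
open import Level using (Level; _⊔_)
open import Relation.Binary.PropositionalEquality as ≡ using (_≡_; _≢_; refl; cong; cong₂)
import Relation.Binary.Reasoning.Setoid as SetoidReasoning
open import Relation.Nullary using (¬_; yes; no; contradiction)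
open import Relation.Nullary.Decidable using (dec-true; dec-false)

private
  variable
    r ℓ m ℓm m′ ℓm′ p : Level

-- Linear maps out of the quotients by multilinear relations

module _ {R : CommutativeRing r ℓ} (M : Module R m ℓm) (N : Module R m′ ℓm′) where

  open CommutativeRing R using (Carrier; _≈_; 0#)
  private
    module M = Module M
    module N = Module N

  record IsMultilinear {k} (Degenerate : Vector M.Carrierᴹ k → Set p)
                       (f : Vector M.Carrierᴹ k → N.Carrierᴹ) : Set (r ⊔ m ⊔ ℓm ⊔ ℓm′ ⊔ p) where
    field
      f-cong        : ∀ {x y} → (∀ i → x i M.≈ᴹ y i) → f x N.≈ᴹ f y
      f-additive    : ∀ x i u v → f (updateAt x i (const (u M.+ᴹ v)))
                        N.≈ᴹ f (updateAt x i (const u)) N.+ᴹ f (updateAt x i (const v))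
      f-homogeneous : ∀ x i a u → f (updateAt x i (const (a M.*ₗ u))) N.≈ᴹ a N.*ₗ f (updateAt x i (const u))
      f-degenerate  : ∀ x → Degenerate x → f x N.≈ᴹ N.0ᴹ

  module Lift {k} (Degenerate : Vector M.Carrierᴹ k → Set p)
              {f : Vector M.Carrierᴹ k → N.Carrierᴹ} (isMultilinear : IsMultilinear Degenerate f) where

    open Multilinear R M k Degenerate
    open IsMultilinear isMultilinear

    lift : Term → N.Carrierᴹ
    lift ⟨ x ⟩   = f x
    lift 𝟘       = N.0ᴹ
    lift (t ⊕ u) = lift t N.+ᴹ lift u
    lift (a ⊙ t) = a N.*ₗ lift t

    -- This is the universal property of the quotient: beyond the equivalence and congruence rules,
    -- every generator of `_≃_` is either a module law of `N` or a field of `IsMultilinear`.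
    lift-cong : ∀ {t u} → t ≃ u → lift t N.≈ᴹ lift u
    lift-cong ≃-refl                = N.≈ᴹ-refl
    lift-cong (≃-sym q)             = N.≈ᴹ-sym (lift-cong q)
    lift-cong (≃-trans q s)         = N.≈ᴹ-trans (lift-cong q) (lift-cong s)
    lift-cong (⟨⟩-cong q)           = f-cong q
    lift-cong (⊕-cong q s)          = N.+ᴹ-cong (lift-cong q) (lift-cong s)
    lift-cong (⊙-cong q s)          = N.*ₗ-cong q (lift-cong s)
    lift-cong (⊕-assoc t u v)       = N.+ᴹ-assoc _ _ _
    lift-cong (⊕-comm t u)          = N.+ᴹ-comm _ _
    lift-cong (⊕-identityˡ t)       = N.+ᴹ-identityˡ _
    lift-cong (⊙-identityˡ t)       = N.*ₗ-identityˡ _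
    lift-cong (⊙-assoc a b t)       = N.*ₗ-assoc _ _ _
    lift-cong (⊙-distribˡ a t u)    = N.*ₗ-distribˡ _ _ _
    lift-cong (⊙-distribʳ t a b)    = N.*ₗ-distribʳ _ _ _
    lift-cong (⊙-zeroˡ t)           = N.*ₗ-zeroˡ _
    lift-cong (⊙-zeroʳ a)           = N.*ₗ-zeroʳ _
    lift-cong (additive x i u v)    = f-additive x i u v
    lift-cong (homogeneous x i a u) = f-homogeneous x i a u
    lift-cong (degenerate x q)      = f-degenerate x q

-- Iterated bilinear actions

  record IsBilinear (act : M.Carrierᴹ → N.Carrierᴹ → N.Carrierᴹ) : Set (r ⊔ m ⊔ ℓm ⊔ m′ ⊔ ℓm′) where
    field
      act-cong : ∀ {u v s t} → u M.≈ᴹ v → s N.≈ᴹ t → act u s N.≈ᴹ act v t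
      act-+ˡ   : ∀ u v s → act (u M.+ᴹ v) s N.≈ᴹ act u s N.+ᴹ act v s
      act-*ˡ   : ∀ a u s → act (a M.*ₗ u) s N.≈ᴹ a N.*ₗ act u s
      act-+ʳ   : ∀ u s t → act u (s N.+ᴹ t) N.≈ᴹ act u s N.+ᴹ act u t
      act-*ʳ   : ∀ a u s → act u (a N.*ₗ s) N.≈ᴹ a N.*ₗ act u s

    act-zeroˡ : ∀ {u} → u M.≈ᴹ M.0ᴹ → ∀ s → act u s N.≈ᴹ N.0ᴹ
    act-zeroˡ {u} u≈0 s = begin
      act u s               ≈⟨ act-cong (M.≈ᴹ-trans u≈0 (M.≈ᴹ-sym (M.*ₗ-zeroˡ M.0ᴹ))) N.≈ᴹ-refl ⟩
      act (0# M.*ₗ M.0ᴹ) s  ≈⟨ act-*ˡ 0# M.0ᴹ s ⟩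
      0# N.*ₗ act M.0ᴹ s    ≈⟨ N.*ₗ-zeroˡ _ ⟩
      N.0ᴹ                  ∎
      where open SetoidReasoning N.≈ᴹ-setoid

    act-zeroʳ : ∀ u {s} → s N.≈ᴹ N.0ᴹ → act u s N.≈ᴹ N.0ᴹ
    act-zeroʳ u {s} s≈0 = begin
      act u s               ≈⟨ act-cong M.≈ᴹ-refl (N.≈ᴹ-trans s≈0 (N.≈ᴹ-sym (N.*ₗ-zeroˡ N.0ᴹ))) ⟩
      act u (0# N.*ₗ N.0ᴹ)  ≈⟨ act-*ʳ 0# u N.0ᴹ ⟩
      0# N.*ₗ act u N.0ᴹ    ≈⟨ N.*ₗ-zeroˡ _ ⟩
      N.0ᴹ                  ∎
      where open SetoidReasoning N.≈ᴹ-setoid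

  -- The action may vary with the position. Tensor coordinates need a different action at each
  -- position, exterior products the same one throughout.
  actAll : ∀ {k} → (Fin k → M.Carrierᴹ → N.Carrierᴹ → N.Carrierᴹ) → Vector M.Carrierᴹ k → N.Carrierᴹ → N.Carrierᴹ
  actAll {zero}  act x s = s
  actAll {suc k} act x s = act zero (head x) (actAll (tail act) (tail x) s)

  private
    variable
      k : ℕ
      act : Fin k → M.Carrierᴹ → N.Carrierᴹ → N.Carrierᴹ

  actAll-cong : (∀ i → IsBilinear (act i)) → ∀ {x y} → (∀ i → x i M.≈ᴹ y i) → ∀ {s t} → s N.≈ᴹ t →
                actAll act x s N.≈ᴹ actAll act y t
  actAll-cong {zero}  bil eq s≈t = s≈t
  actAll-cong {suc k} bil eq s≈t =
    IsBilinear.act-cong (bil zero) (eq zero) (actAll-cong (bil ∘ suc) (eq ∘ suc) s≈t)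

  actAll-additive : (∀ i → IsBilinear (act i)) → ∀ x i u v s →
    actAll act (updateAt x i (const (u M.+ᴹ v))) s
      N.≈ᴹ actAll act (updateAt x i (const u)) s N.+ᴹ actAll act (updateAt x i (const v)) s
  actAll-additive {suc k} bil x zero    u v s = IsBilinear.act-+ˡ (bil zero) u v _
  actAll-additive {suc k} bil x (suc i) u v s = N.≈ᴹ-trans
    (IsBilinear.act-cong (bil zero) M.≈ᴹ-refl (actAll-additive (bil ∘ suc) (tail x) i u v s))
    (IsBilinear.act-+ʳ (bil zero) (head x) _ _)

  actAll-homogeneous : (∀ i → IsBilinear (act i)) → ∀ x i a u s →
    actAll act (updateAt x i (const (a M.*ₗ u))) s N.≈ᴹ a N.*ₗ actAll act (updateAt x i (const u)) s
  actAll-homogeneous {suc k} bil x zero    a u s = IsBilinear.act-*ˡ (bil zero) a u _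
  actAll-homogeneous {suc k} bil x (suc i) a u s = N.≈ᴹ-trans
    (IsBilinear.act-cong (bil zero) M.≈ᴹ-refl (actAll-homogeneous (bil ∘ suc) (tail x) i a u s))
    (IsBilinear.act-*ʳ (bil zero) a (head x) _)

  -- Whatever state the inner actions produce is killed at position `i`, and the outer actions
  -- preserve zero.
  actAll-vanish : (∀ i → IsBilinear (act i)) → ∀ x i → (∀ s → act i (x i) s N.≈ᴹ N.0ᴹ) → ∀ s →
                  actAll act x s N.≈ᴹ N.0ᴹ
  actAll-vanish {suc k} bil x zero    van s = van _
  actAll-vanish {suc k} bil x (suc i) van s =
    IsBilinear.act-zeroʳ (bil zero) (head x) (actAll-vanish (bil ∘ suc) (tail x) i van s)

  -- Square-zero actions are alternating

  module SquareZero (act : M.Carrierᴹ → N.Carrierᴹ → N.Carrierᴹ) (bil : IsBilinear act)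
                    (square : ∀ u s → act u (act u s) N.≈ᴹ N.0ᴹ) where

    open IsBilinear bil
    open SetoidReasoning N.≈ᴹ-setoid

    -- Polarisation: expand the square of the action of `u + v` and drop the squares of `u` and `v`.
    anticommute : ∀ u v s → act u (act v s) N.+ᴹ act v (act u s) N.≈ᴹ N.0ᴹ
    anticommute u v s = begin
      uv N.+ᴹ vu
        ≈⟨ N.+ᴹ-cong (N.+ᴹ-identityˡ uv) (N.+ᴹ-identityʳ vu) ⟨
      (N.0ᴹ N.+ᴹ uv) N.+ᴹ (vu N.+ᴹ N.0ᴹ)
        ≈⟨ N.+ᴹ-cong (N.+ᴹ-congʳ (square u s)) (N.+ᴹ-congˡ (square v s)) ⟨
      (act u (act u s) N.+ᴹ uv) N.+ᴹ (vu N.+ᴹ act v (act v s))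
        ≈⟨ N.+ᴹ-cong (act-+ʳ u _ _) (act-+ʳ v _ _) ⟨
      act u (act u s N.+ᴹ act v s) N.+ᴹ act v (act u s N.+ᴹ act v s)
        ≈⟨ act-+ˡ u v _ ⟨
      act (u M.+ᴹ v) (act u s N.+ᴹ act v s)
        ≈⟨ act-cong M.≈ᴹ-refl (act-+ˡ u v s) ⟨
      act (u M.+ᴹ v) (act (u M.+ᴹ v) s)
        ≈⟨ square (u M.+ᴹ v) s ⟩
      N.0ᴹ ∎
      where
      uv = act u (act v s)
      vu = act v (act u s)

    -- `anticommute` exchanges `u` with the outermost factor. After the exchange `u` acts on a
    -- shorter product, which vanishes by induction; the base case is the square of `u`.
    act-absorbed : ∀ {k} (x : Vector M.Carrierᴹ k) i {u} → u M.≈ᴹ x i → ∀ s →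
                   act u (actAll (const act) x s) N.≈ᴹ N.0ᴹ
    act-absorbed x zero    {u} u≈xᵢ s = N.≈ᴹ-trans (act-cong u≈xᵢ N.≈ᴹ-refl) (square (head x) _)
    act-absorbed x (suc i) {u} u≈xᵢ s = begin
      act u (act (head x) rest)                                 ≈⟨ N.+ᴹ-identityʳ _ ⟨
      act u (act (head x) rest) N.+ᴹ N.0ᴹ
        ≈⟨ N.+ᴹ-congˡ (act-zeroʳ (head x) (act-absorbed (tail x) i u≈xᵢ s)) ⟨
      act u (act (head x) rest) N.+ᴹ act (head x) (act u rest)  ≈⟨ anticommute u (head x) rest ⟩
      N.0ᴹ                                                      ∎
      where rest = actAll (const act) (tail x) s

    -- Strip outer factors until one of the two equal entries is outermost; the product of the
    -- others then absorbs it.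
    actAll-alternating : ∀ {k} (x : Vector M.Carrierᴹ k) → Exterior.HasRepetition R M x → ∀ s →
                         actAll (const act) x s N.≈ᴹ N.0ᴹ
    actAll-alternating x (zero  , zero  , i≢j , eq) s = contradiction refl i≢j
    actAll-alternating x (zero  , suc j , i≢j , eq) s = act-absorbed (tail x) j eq s
    actAll-alternating x (suc i , zero  , i≢j , eq) s = act-absorbed (tail x) i (M.≈ᴹ-sym eq) s
    actAll-alternating x (suc i , suc j , i≢j , eq) s =
      act-zeroʳ (head x) (actAll-alternating (tail x) (i , j , i≢j ∘ cong suc , eq) s)

-- Coding of index tuples and positions

-- `remQuot` separates the leading digit from the code of the remaining digits, and `combine`
-- recovers the number from both.
finToFun-injective : ∀ {m} n {a b : Fin (m ^ n)} → (∀ l → finToFun {m} {n} a l ≡ finToFun b l) → a ≡ b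
finToFun-injective {m} zero    {zero} {zero} eq = refl
finToFun-injective {m} (suc n) {a} {b} eq = begin
  a                                  ≡⟨ combine-remQuot {m} (m ^ n) a ⟨
  uncurry combine (remQuot {m} (m ^ n) a)
    ≡⟨ cong₂ combine (eq zero) (finToFun-injective n (eq ∘ suc)) ⟩
  uncurry combine (remQuot {m} (m ^ n) b)
    ≡⟨ combine-remQuot {m} (m ^ n) b ⟩
  b                                  ∎
  where open ≡.≡-Reasoning

↑ˡ≢↑ʳ : ∀ {m n} (i : Fin m) (j : Fin n) → i ↑ˡ n ≢ m ↑ʳ j
↑ˡ≢↑ʳ {suc m} zero    j ()
↑ˡ≢↑ʳ {suc m} (suc i) j eq = ↑ˡ≢↑ʳ i j (suc-injective eq)

-- Coordinates on exterior powers

module _ (R : CommutativeRing r ℓ) where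

  open CommutativeRing R hiding (_+_; _*_; zero) renaming (refl to ≈-refl; sym to ≈-sym; trans to ≈-trans)
  private
    module R = CommutativeRing R

  -- Fock m is the exterior algebra of R^m: the pair (f , g) stands for f + e₀ ∧ g, and
  -- create v is exterior multiplication by v.
  Fock : ℕ → Module R r ℓ
  Fock zero    = TensorUnit.⟨module⟩
  Fock (suc m) = ⟨module⟩ (Fock m) (Fock m)

  State : ℕ → Set r
  State m = Module.Carrierᴹ (Fock m)

  create : ∀ m → Vector Carrier m → State m → State m
  create zero    v s       = 0#
  create (suc m) v (f , g) = create m (tail v) f , head v *ₗ f +ᴹ (- 1#) *ₗ create m (tail v) g
    where open Module (Fock m)

  vacuum : ∀ m → State m
  vacuum zero    = 1#
  vacuum (suc m) = vacuum m , Module.0ᴹ (Fock m)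

  -- The coefficient of the product of all `m` basis vectors: at each level `g` collects the terms
  -- containing e₀.
  top : ∀ m → State m → Carrier
  top zero    s       = s
  top (suc m) (f , g) = top m g

  top-cong : ∀ m {s t} → Module._≈ᴹ_ (Fock m) s t → top m s ≈ top m t
  top-cong zero    s≈t       = s≈t
  top-cong (suc m) (_ , g≈h) = top-cong m g≈h

  top-0 : ∀ m → top m (Module.0ᴹ (Fock m)) ≈ 0#
  top-0 zero    = ≈-refl
  top-0 (suc m) = top-0 m

  create-bilinear : ∀ m → IsBilinear (R ^ᴹ m) (Fock m) (create m)
  create-bilinear zero = record
    { act-cong = λ _ _ → ≈-refl
    ; act-+ˡ   = λ _ _ _ → ≈-sym (+-identityˡ 0#)
    ; act-*ˡ   = λ a _ _ → ≈-sym (zeroʳ a)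
    ; act-+ʳ   = λ _ _ _ → ≈-sym (+-identityˡ 0#)
    ; act-*ʳ   = λ a _ _ → ≈-sym (zeroʳ a) }
  create-bilinear (suc m) = record
    { act-cong = λ u≈v (p , q) → act-cong (u≈v ∘ suc) p ,
        +ᴹ-cong (*ₗ-cong (u≈v zero) p) (*ₗ-congˡ (act-cong (u≈v ∘ suc) q))
    ; act-+ˡ   = λ u v (f , g) → act-+ˡ (tail u) (tail v) f ,
        ≈ᴹ-trans (+ᴹ-cong (*ₗ-distribʳ f (head u) (head v))
                          (≈ᴹ-trans (*ₗ-congˡ (act-+ˡ (tail u) (tail v) g)) (*ₗ-distribˡ _ _ _)))
                 (interchange _ _ _ _)
    ; act-*ˡ   = λ a u (f , g) → act-*ˡ a (tail u) f ,
        ≈ᴹ-trans (+ᴹ-cong (*ₗ-assoc a (head u) f)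
                          (≈ᴹ-trans (*ₗ-congˡ (act-*ˡ a (tail u) g)) (*ₗ-comm _ _ _)))
                 (≈ᴹ-sym (*ₗ-distribˡ a _ _))
    ; act-+ʳ   = λ u (f , g) (f′ , g′) → act-+ʳ (tail u) f f′ ,
        ≈ᴹ-trans (+ᴹ-cong (*ₗ-distribˡ (head u) f f′)
                          (≈ᴹ-trans (*ₗ-congˡ (act-+ʳ (tail u) g g′)) (*ₗ-distribˡ _ _ _)))
                 (interchange _ _ _ _)
    ; act-*ʳ   = λ a u (f , g) → act-*ʳ a (tail u) f ,
        ≈ᴹ-trans (+ᴹ-cong (*ₗ-comm (head u) a f)
                          (≈ᴹ-trans (*ₗ-congˡ (act-*ʳ a (tail u) g)) (*ₗ-comm _ _ _)))
                 (≈ᴹ-sym (*ₗ-distribˡ a _ _)) }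
    where
    open Module (Fock m)
    open IsBilinear (create-bilinear m)
    open CommutativeSemigroupProperties (CommutativeMonoid.commutativeSemigroup +ᴹ-commutativeMonoid)
      using (interchange)

  -- By induction `A` squares to zero, so only two cross terms `v₀ *ₗ A f` remain. They cancel
  -- thanks to the sign in `create`, which comes from moving `tail v` past e₀.
  create-square : ∀ m v s → Module._≈ᴹ_ (Fock m) (create m v (create m v s)) (Module.0ᴹ (Fock m))
  create-square zero    v s       = ≈-refl
  create-square (suc m) v (f , g) = create-square m (tail v) f , (begin
    v₀ *ₗ A f +ᴹ ε *ₗ A (v₀ *ₗ f +ᴹ ε *ₗ A g)
      ≈⟨ +ᴹ-congˡ (*ₗ-congˡ (≈ᴹ-trans (act-+ʳ _ _ _) (+ᴹ-cong (act-*ʳ _ _ _)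
           (≈ᴹ-trans (act-*ʳ _ _ _) (≈ᴹ-trans (*ₗ-congˡ (create-square m (tail v) g)) (*ₗ-zeroʳ ε)))))) ⟩
    v₀ *ₗ A f +ᴹ ε *ₗ (v₀ *ₗ A f +ᴹ 0ᴹ)
      ≈⟨ +ᴹ-cong (≈ᴹ-sym (*ₗ-identityˡ _)) (*ₗ-congˡ (+ᴹ-identityʳ _)) ⟩
    1# *ₗ v₀ *ₗ A f +ᴹ ε *ₗ v₀ *ₗ A f
      ≈⟨ *ₗ-distribʳ _ 1# ε ⟨
    (1# R.+ ε) *ₗ v₀ *ₗ A f
      ≈⟨ *ₗ-congʳ (-‿inverseʳ 1#) ⟩
    0# *ₗ v₀ *ₗ A f
      ≈⟨ *ₗ-zeroˡ _ ⟩
    0ᴹ ∎)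
    where
    open Module (Fock m)
    open IsBilinear (create-bilinear m)
    open SetoidReasoning ≈ᴹ-setoid
    v₀ = head v
    ε  = - 1#
    A  = create m (tail v)

  createAll : ∀ {m k} → Vector (Vector Carrier m) k → State m → State m
  createAll {m} = actAll (R ^ᴹ m) (Fock m) (const (create m))

  -- Vectors without an e₀ component never create e₀, so the product is computed in the smaller Fock
  -- space.
  createAll-tail : ∀ {m k} (w : Vector (Vector Carrier (suc m)) k) → (∀ i → head (w i) ≈ 0#) → ∀ f →
                   Module._≈ᴹ_ (Fock (suc m)) (createAll {suc m} w (f , Module.0ᴹ (Fock m)))
                                              (createAll {m} (tail ∘ w) f , Module.0ᴹ (Fock m))
  createAll-tail {m} {zero}  w w₀≈0 f = Module.≈ᴹ-refl (Fock (suc m))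
  createAll-tail {m} {suc k} w w₀≈0 f =
    let p , q = createAll-tail {m} (tail w) (w₀≈0 ∘ suc) f in
    act-cong (λ _ → ≈-refl) p ,
    ≈ᴹ-trans (+ᴹ-cong (≈ᴹ-trans (*ₗ-congʳ (w₀≈0 zero)) (*ₗ-zeroˡ _))
                      (≈ᴹ-trans (*ₗ-congˡ (act-zeroʳ _ q)) (*ₗ-zeroʳ _)))
             (+ᴹ-identityˡ 0ᴹ)
    where
    open Module (Fock m)
    open IsBilinear (create-bilinear m)

  -- The outermost vector is e₀ and the others have no e₀ component, so `createAll-tail` reduces the
  -- claim to dimension `m`.
  top-createAll-basis : ∀ m → top m (createAll {m} (basis R) (vacuum m)) ≈ 1#
  top-createAll-basis zero    = ≈-refl
  top-createAll-basis (suc m) =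
    let p , q = createAll-tail {m} (basis R ∘ suc) (λ _ → ≈-refl) (vacuum m) in
    ≈-trans (top-cong m (≈ᴹ-trans
      (+ᴹ-cong (≈ᴹ-trans (*ₗ-identityˡ _) p)
               (≈ᴹ-trans (*ₗ-congˡ (act-zeroʳ _ q)) (*ₗ-zeroʳ _)))
      (+ᴹ-identityʳ _)))
    (top-createAll-basis m)
    where
    open Module (Fock m)
    open IsBilinear (create-bilinear m)

  basis-diagonal : ∀ {k} (i : Fin k) → basis R i i ≈ 1#
  basis-diagonal i rewrite dec-true (i ≟ i) refl = ≈-refl

  basis-≢ : ∀ {k} (i j : Fin k) → i ≢ j → basis R i j ≈ 0#
  basis-≢ i j i≢j rewrite dec-false (i ≟ j) i≢j = ≈-refl

  -- Dual basis of the tensor power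

  module _ (d k : ℕ) where

    private
      RModule : Module R r ℓ
      RModule = TensorUnit.⟨module⟩

    open Cayley R d k using (V)
    open TensorPower R (R ^ᴹ k) d using (Term; ⨂_)

    Index : Set
    Index = Vector (Fin k) d

    pureBasis : Index → Term
    pureBasis a = ⨂ (λ j → basis R (a j))

    module _ (a : Index) where

      coordAct : Fin d → Vector Carrier k → Carrier → Carrier
      coordAct j u s = u (a j) R.* s

      coordAct-bilinear : ∀ j → IsBilinear (R ^ᴹ k) RModule (coordAct j)
      coordAct-bilinear j = record
        { act-cong = λ u≈v s≈t → *-cong (u≈v (a j)) s≈t
        ; act-+ˡ   = λ u v s → distribʳ s _ _
        ; act-*ˡ   = λ b u s → *-assoc b _ s
        ; act-+ʳ   = λ u s t → distribˡ _ s t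
        ; act-*ʳ   = λ b u s → Module.*ₗ-comm RModule _ b s }

      -- The product of the coordinates `x j (a j)`: on pure tensors, the functional dual to
      -- `pureBasis a`. As an iterated action it inherits multilinearity from the lemmas on
      -- `actAll`.
      coordPure : Vector (Vector Carrier k) d → Carrier
      coordPure x = actAll (R ^ᴹ k) RModule coordAct x 1#

      coordPure-multilinear : IsMultilinear (R ^ᴹ k) RModule (λ _ → ⊥) coordPure
      coordPure-multilinear = record
        { f-cong        = λ eq → actAll-cong (R ^ᴹ k) RModule coordAct-bilinear eq ≈-refl
        ; f-additive    = λ x i u v → actAll-additive (R ^ᴹ k) RModule coordAct-bilinear x i u v 1#
        ; f-homogeneous = λ x i b u → actAll-homogeneous (R ^ᴹ k) RModule coordAct-bilinear x i b u 1#
        ; f-degenerate  = λ _ () }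

      open Lift (R ^ᴹ k) RModule (λ _ → ⊥) coordPure-multilinear public
        renaming (lift to coord; lift-cong to coord-cong)

    coord-basis-≢ : ∀ (a b : Index) j → b j ≢ a j → coord a (pureBasis b) ≈ 0#
    coord-basis-≢ a b j bⱼ≢aⱼ = actAll-vanish (R ^ᴹ k) RModule (coordAct-bilinear a) _ j
      (λ s → ≈-trans (*-congʳ (basis-≢ (b j) (a j) bⱼ≢aⱼ)) (zeroˡ s)) 1#

    coord-basis-≡ : ∀ a → coord a (pureBasis a) ≈ 1#
    coord-basis-≡ a = go a
      where
      -- The number of tensor factors is freed from `d` to allow induction.
      go : ∀ {e} (a : Vector (Fin k) e) →
           actAll (R ^ᴹ k) RModule (λ j u s → u (a j) R.* s) (λ j → basis R (a j)) 1# ≈ 1#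
      go {zero}  a = ≈-refl
      go {suc e} a = ≈-trans (*-cong (basis-diagonal (a zero)) (go (tail a))) (*-identityˡ 1#)

    -- Exterior products in chosen coordinates

    module _ {m} (t : Vector Index m) where

      coords : Term → Vector Carrier m
      coords u c = coord (t c) u

      private
        wedgeAct : Term → State m → State m
        wedgeAct u = create m (coords u)

        wedgeAct-bilinear : IsBilinear V (Fock m) wedgeAct
        wedgeAct-bilinear = record
          { act-cong = λ u≃v → act-cong (λ c → coord-cong (t c) u≃v)
          ; act-+ˡ   = λ u v → act-+ˡ (coords u) (coords v)
          ; act-*ˡ   = λ b u → act-*ˡ b (coords u)
          ; act-+ʳ   = λ u → act-+ʳ (coords u)
          ; act-*ʳ   = λ b u → act-*ʳ b (coords u) }
          where open IsBilinear (create-bilinear m)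

      -- The image of the exterior product of the `x i` under the map induced by `coords`, which
      -- reads off the coordinates indexed by `t`. Its linear extension to the exterior power is
      -- `restrict`.
      wedge : ∀ {n} → Vector Term n → State m
      wedge x = actAll V (Fock m) (const wedgeAct) x (vacuum m)

      wedge-multilinear : ∀ {n} → IsMultilinear V (Fock m) (Exterior.HasRepetition R V) (wedge {n})
      wedge-multilinear = record
        { f-cong        = λ eq → actAll-cong V (Fock m) (const wedgeAct-bilinear) eq (Module.≈ᴹ-refl (Fock m))
        ; f-additive    = λ x i u v → actAll-additive V (Fock m) (const wedgeAct-bilinear) x i u v (vacuum m)
        ; f-homogeneous = λ x i b u → actAll-homogeneous V (Fock m) (const wedgeAct-bilinear) x i b u (vacuum m)
        ; f-degenerate  = λ x rep → SquareZero.actAll-alternating V (Fock m) wedgeAct wedgeAct-bilinear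
                            (λ u → create-square m (coords u)) x rep (vacuum m) }

      module _ {n : ℕ} where
        open Lift V (Fock m) (Exterior.HasRepetition R V {n}) wedge-multilinear public
          renaming (lift to restrict; lift-cong to restrict-cong)

      wedge-vanish : ∀ {n} (x : Vector Term n) i → (∀ c → coord (t c) (x i) ≈ 0#) →
                     Module._≈ᴹ_ (Fock m) (wedge x) (Module.0ᴹ (Fock m))
      wedge-vanish x i coords≈0 = actAll-vanish V (Fock m) (const wedgeAct-bilinear) x i
        (IsBilinear.act-zeroˡ (create-bilinear m) coords≈0) (vacuum m)

    -- For injective `t`, `coords` sends the chosen tensors to the standard basis, whose product has
    -- top coefficient 1. This is what shows that wedges of distinct basis tensors are nonzero.
    top-wedge-basis : ∀ {m} (t : Vector Index m) → (∀ {i j} → (∀ l → t i l ≡ t j l) → i ≡ j) →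
                      top m (wedge t (pureBasis ∘ t)) ≈ 1#
    top-wedge-basis {m} t t-injective = ≈-trans (top-cong m (go (pureBasis ∘ t) (basis R) coords-basis))
                                                (top-createAll-basis m)
      where
      go : ∀ {n} (x : Vector Term n) (w : Vector (Vector Carrier m) n) → (∀ i c → coords t (x i) c ≈ w i c) →
           Module._≈ᴹ_ (Fock m) (wedge t x) (createAll {m} w (vacuum m))
      go {zero}  x w eq = Module.≈ᴹ-refl (Fock m)
      go {suc n} x w eq = IsBilinear.act-cong (create-bilinear m) (eq zero) (go (tail x) (tail w) (eq ∘ suc))

      coords-basis : ∀ i c → coords t (pureBasis (t i)) c ≈ basis R i c
      coords-basis i c with i ≟ c
      ... | yes refl = coord-basis-≡ (t i)
      ... | no i≢c =
        -- Distinct index tuples differ at some position, found by search because equality on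
        -- `Fin k` is decidable.
        let j , tᵢⱼ≢tcⱼ = ¬∀⟶∃¬ d (λ l → t i l ≡ t c l) (λ l → t i l ≟ t c l) (i≢c ∘ t-injective)
        in coord-basis-≢ (t c) (t i) j tᵢⱼ≢tcⱼ

-- The layer of basis tensors with first index 0

  module Layer (d k : ℕ) where

    open Cayley R (suc d) (suc k)
    private
      module P {n : ℕ} = Exterior.Power R V n
    open P

    factors : Vector (Permutation′ (suc k)) (suc d) → Vector (Module.Carrierᴹ V) (suc k)
    factors π i = pureBasis (suc d) (suc k) (λ j → π j ⟨$⟩ʳ i)

    -- ω is a linear combination of the wedges of `factors π`, and `_∧_` computes along its left
    -- argument. Hence a property stable under linear combinations passes from these wedges to ω.
    ω∧-closed : ∀ {n} (v : Term {n}) (P : Term {suc k + n} → Set p) → P 𝟘 →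
                (∀ t u → P t → P u → P (t ⊕ u)) → (∀ a t → P t → P (a ⊙ t)) →
                (∀ π → P (⟨ factors π ⟩ ∧ v)) → P (ω ∧ v)
    ω∧-closed v P P-𝟘 P-⊕ P-⊙ P-factors = go (tuples (permutations (suc k)) (suc d))
      where
      go : ∀ πs → P (foldr _⊕_ 𝟘 (List.map summand πs) ∧ v)
      go []       = P-𝟘
      go (π ∷ πs) = P-⊕ _ _ (P-⊙ _ _ (P-factors π)) (go πs)

    -- Since `π zero` is a bijection, each term of ω has exactly one factor with first index 0; this
    -- is its position.
    zeroFactor : Vector (Permutation′ (suc k)) (suc d) → Fin (suc k)
    zeroFactor π = π zero ⟨$⟩ˡ zero

    layer : Vector (Index (suc d) (suc k)) (suc k ^ d)
    layer c zero    = zero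
    layer c (suc j) = finToFun c j

    layer-injective : ∀ {a b} → (∀ l → layer a l ≡ layer b l) → a ≡ b
    layer-injective eq = finToFun-injective d (eq ∘ suc)

    ⋀layer : Term {suc k ^ d}
    ⋀layer = ⟨ pureBasis (suc d) (suc k) ∘ layer ⟩

    -- The factor at `zeroFactor π` lies in the layer, so it occurs a second time among the factors
    -- of `⋀layer`.
    ω∧⋀layer≃𝟘 : ω ∧ ⋀layer ≃ 𝟘
    ω∧⋀layer≃𝟘 = ω∧-closed ⋀layer (_≃ 𝟘) ≃-refl
      (λ _ _ t≃𝟘 u≃𝟘 → ≃-trans (⊕-cong t≃𝟘 u≃𝟘) (⊕-identityˡ 𝟘))
      (λ a _ t≃𝟘 → ≃-trans (⊙-cong ≈-refl t≃𝟘) (⊙-zeroʳ a))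
      (λ π → degenerate _ (repeated π))
      where
      y = pureBasis (suc d) (suc k) ∘ layer
      repeated : ∀ π → Exterior.HasRepetition R V (factors π ++ y)
      repeated π = i ↑ˡ _ , suc k ↑ʳ c , ↑ˡ≢↑ʳ i c ,
        ≈ᴹ-trans (≈ᴹ-reflexive (lookup-++ˡ (factors π) y i))
        (≈ᴹ-trans (TensorPower.⟨⟩-cong same)
        (≈ᴹ-sym (≈ᴹ-reflexive (lookup-++ʳ (factors π) y c))))
        where
        open Module V using (≈ᴹ-trans; ≈ᴹ-sym; ≈ᴹ-reflexive)
        i = zeroFactor π
        -- The position of this factor in the layer is the code of its indices after the first.
        c = funToFin (λ j → π (suc j) ⟨$⟩ʳ i)
        same : ∀ j l → basis R (π j ⟨$⟩ʳ i) l ≈ basis R (layer c j) l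
        same zero    l = reflexive (cong (λ a → basis R a l) (inverseʳ (π zero)))
        same (suc j) l = reflexive (cong (λ a → basis R a l)
          (≡.sym (finToFun-funToFin (λ j → π (suc j) ⟨$⟩ʳ i) j)))

    -- `L` sends both `⋀layer` and `𝟘` to zero, but the top coefficient in the coordinates of the
    -- layer distinguishes them.
    L-not-injective : ¬ 1# ≈ 0# →
      ¬ Injective (Module._≈ᴹ_ (⋀ (suc k ^ d))) (Module._≈ᴹ_ (⋀ (suc k + suc k ^ d))) (L (suc k ^ d))
    L-not-injective 1≉0 injective = 1≉0 (begin
      1#                            ≈⟨ top-wedge-basis (suc d) (suc k) layer layer-injective ⟨
      top N (restrict′ ⋀layer)      ≈⟨ top-cong N (restrict-cong (suc d) (suc k) layer ⋀layer≃𝟘) ⟩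
      top N (restrict′ 𝟘)           ≈⟨ top-0 N ⟩
      0#                            ∎)
      where
      open SetoidReasoning setoid
      N = suc k ^ d
      restrict′ = restrict (suc d) (suc k) layer {N}
      ⋀layer≃𝟘 : ⋀layer ≃ 𝟘
      ⋀layer≃𝟘 = injective (≃-trans ω∧⋀layer≃𝟘 (≃-sym (Exterior.∧-zeroʳ R V ω)))

    -- Tensors off the layer and failure of surjectivity

    module _ {n : ℕ} (small : suc k + n ≤ k * suc k ^ d) where

      private
        -- There are `k * suc k ^ d` basis tensors with nonzero first index; `small` embeds the
        -- positions among them. The first component is that index less one, the second codes the
        -- other indices.
        split : Fin (suc k + n) → Fin k × Fin (suc k ^ d)
        split c = remQuot (suc k ^ d) (inject≤ c small)

        split-injective : ∀ {a b} → split a ≡ split b → a ≡ b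
        split-injective {a} {b} eq = inject≤-injective small small a b
          (≡.trans (≡.sym (combine-remQuot {k} (suc k ^ d) (inject≤ a small)))
          (≡.trans (cong (uncurry combine) eq) (combine-remQuot {k} (suc k ^ d) (inject≤ b small))))

      offLayer : Vector (Index (suc d) (suc k)) (suc k + n)
      offLayer c zero    = suc (proj₁ (split c))
      offLayer c (suc j) = finToFun (proj₂ (split c)) j

      offLayer-injective : ∀ {a b} → (∀ l → offLayer a l ≡ offLayer b l) → a ≡ b
      offLayer-injective eq = split-injective
        (cong₂ _,_ (suc-injective (eq zero)) (finToFun-injective d (eq ∘ suc)))

      private
        restrict′ : Term {suc k + n} → State (suc k + n)
        restrict′ = restrict (suc d) (suc k) offLayer

      open Module (Fock (suc k + n)) using (_≈ᴹ_; 0ᴹ; ≈ᴹ-refl; ≈ᴹ-sym; ≈ᴹ-trans; +ᴹ-cong; +ᴹ-identityˡ; *ₗ-congˡ; *ₗ-zeroʳ)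

      -- Every term of ω has a factor with first index 0, and all coordinates of that factor along
      -- `offLayer` are zero.
      restrict-ω∧ : ∀ v → restrict′ (ω ∧ v) ≈ᴹ 0ᴹ
      restrict-ω∧ v = ω∧-closed v (λ t → restrict′ t ≈ᴹ 0ᴹ) ≈ᴹ-refl ⊕-null ⊙-null (λ π → factors∧-null π v)
        where
        ⊕-null : ∀ t u → restrict′ t ≈ᴹ 0ᴹ → restrict′ u ≈ᴹ 0ᴹ → restrict′ (t ⊕ u) ≈ᴹ 0ᴹ
        ⊕-null t u t≈0 u≈0 = ≈ᴹ-trans (+ᴹ-cong t≈0 u≈0) (+ᴹ-identityˡ 0ᴹ)
        ⊙-null : ∀ a t → restrict′ t ≈ᴹ 0ᴹ → restrict′ (a ⊙ t) ≈ᴹ 0ᴹ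
        ⊙-null a t t≈0 = ≈ᴹ-trans (*ₗ-congˡ t≈0) (*ₗ-zeroʳ a)
        -- With a pure left argument `_∧_` computes along `v`, so induction on the term `v` reduces
        -- to pure wedges.
        factors∧-null : ∀ π v → restrict′ (⟨ factors π ⟩ ∧ v) ≈ᴹ 0ᴹ
        factors∧-null π ⟨ y ⟩   = wedge-vanish (suc d) (suc k) offLayer (factors π ++ y) (zeroFactor π ↑ˡ n) λ c →
          ≈-trans (reflexive (cong (coord (suc d) (suc k) (offLayer c)) (lookup-++ˡ (factors π) y (zeroFactor π))))
                  (coord-basis-≢ (suc d) (suc k) (offLayer c) (λ j → π j ⟨$⟩ʳ zeroFactor π) zero λ eq → 0≢1+n (≡.trans (≡.sym (inverseʳ (π zero))) eq))
        factors∧-null π 𝟘       = ≈ᴹ-refl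
        factors∧-null π (u ⊕ v) = ⊕-null (⟨ factors π ⟩ ∧ u) (⟨ factors π ⟩ ∧ v) (factors∧-null π u) (factors∧-null π v)
        factors∧-null π (a ⊙ v) = ⊙-null a (⟨ factors π ⟩ ∧ v) (factors∧-null π v)

      -- The wedge of the `offLayer` tensors has top coefficient 1, while everything in the image of
      -- `L` restricts to zero.
      L-not-surjective : ¬ 1# ≈ 0# → ¬ Surjective (Module._≈ᴹ_ (⋀ n)) (Module._≈ᴹ_ (⋀ (suc k + n))) (L n)
      L-not-surjective 1≉0 surjective =
        let v , Lv≃ = surjective ⟨ pureBasis (suc d) (suc k) ∘ offLayer ⟩ in 1≉0
        (≈-trans (≈-sym (top-wedge-basis (suc d) (suc k) offLayer offLayer-injective))
        (≈-trans (top-cong (suc k + n) (≈ᴹ-trans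
                   (≈ᴹ-sym (restrict-cong (suc d) (suc k) offLayer (Lv≃ ≃-refl))) (restrict-ω∧ v)))
                 (top-0 (suc k + n))))

-- Numerical bounds and conclusion

-- A positive exponent gives `suc k ≤ K`, so the left side is at most `2 * K`, and `k` is at least
-- 2.
offLayer-room : ∀ d k → 1 ≤ d → 2 ≤ k → suc k + suc k ^ d ≤ k * suc k ^ d
offLayer-room (suc d) k _ 2≤k = begin
  suc k + K      ≡⟨ cong (_+ K) (ℕ.*-identityʳ (suc k)) ⟨
  suc k * 1 + K  ≤⟨ ℕ.+-monoˡ-≤ K (ℕ.*-monoʳ-≤ (suc k) (ℕ.m^n>0 (suc k) d)) ⟩
  K + K          ≡⟨ cong (K +_) (ℕ.+-identityʳ K) ⟨
  2 * K          ≤⟨ ℕ.*-monoˡ-≤ K 2≤k ⟩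
  k * K          ∎
  where
  open ℕ.≤-Reasoning
  K = suc k ^ suc d

rank-deficient : (R : CommutativeRing r ℓ) → ¬ CommutativeRing._≈_ R (CommutativeRing.1# R) (CommutativeRing.0# R) →
  ∀ d k → 3 ≤ d → 2 < k → let open Cayley R d k in
  ∃[ n ] (n ≤ k ^ d ∸ k
  × ¬ Injective (Module._≈ᴹ_ (⋀ n)) (Module._≈ᴹ_ (⋀ (k + n))) (L n)
  × ¬ Surjective (Module._≈ᴹ_ (⋀ n)) (Module._≈ᴹ_ (⋀ (k + n))) (L n))
rank-deficient R 1≉0 (suc d) (suc k) (s≤s 2≤d) (s≤s 2≤k) =
  suc k ^ d , n≤ , Layer.L-not-injective R d k 1≉0 , Layer.L-not-surjective R d k fits 1≉0
  where
  fits : suc k + suc k ^ d ≤ k * suc k ^ d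
  fits = offLayer-room d k (ℕ.≤-trans (ℕ.n≤1+n 1) 2≤d) 2≤k
  -- The tensors off the layer number `k * suc k ^ d`, at most the dimension `suc k ^ suc d` of the
  -- whole space, so `fits` also bounds `n`.
  n≤ : suc k ^ d ≤ suc k ^ suc d ∸ suc k
  n≤ = ℕ.m+n≤o⇒m≤o∸n (suc k ^ d) (begin
    suc k ^ d + suc k  ≡⟨ ℕ.+-comm (suc k ^ d) (suc k) ⟩
    suc k + suc k ^ d  ≤⟨ fits ⟩
    k * suc k ^ d      ≤⟨ ℕ.m≤n+m (k * suc k ^ d) (suc k ^ d) ⟩
    suc k ^ suc d      ∎)
    where open ℕ.≤-Reasoning

-- The real parts are constant sequences at distance 1, so the choice ε = 1 would give `1 < 1`.
1≉0 : ¬ CommutativeRing._≈_ ℂ (CommutativeRing.1# ℂ) (CommutativeRing.0# ℂ)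
1≉0 (1≃0 , _) with N , close ← Real.null 1≃0 1ℚ (ℚ.positive⁻¹ 1ℚ) = ℚ.<-irrefl refl (close N ℕ.≤-refl)

theorem1p9 : (d k : ℕ) → 3 ≤ d → d % 2 ≡ 1 → 2 < k →
    let open Cayley ℂ d k in
    ¬ (∀ n → n ≤ k ^ d ∸ k → FullRank (⋀ n) (⋀ (k + n)) (L n))
    × ∃[ n ] (n ≤ k ^ d ∸ k
    × ¬ Injective (Module._≈ᴹ_ (⋀ n)) (Module._≈ᴹ_ (⋀ (k + n))) (L n)
    × ¬ Surjective (Module._≈ᴹ_ (⋀ n)) (Module._≈ᴹ_ (⋀ (k + n))) (L n))
theorem1p9 d k 3≤d _ 2<k =
  let n , n≤ , notInjective , notSurjective = rank-deficient ℂ 1≉0 d k 3≤d 2<k in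
  (λ fullRank → [ notInjective , notSurjective ]′ (fullRank n n≤)) , n , n≤ , notInjective , notSurjective
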